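{- Let $a_1(n),a_2(n),m(n)$ be integer-valued quasi-polynomials with positive leading coefficients. If $\mathrm{ggcd}(a_1(n),a_2(n))=1$, then $$p_{\{a_1(n),a_2(n)\}}(m(n))=\frac{m(n)}{a_1(n)a_2(n)}-\bigg\{\frac{a_1(n)^{ -1}m(n)}{a_2(n)}\bigg\}-\bigg\{\frac{a_2(n)^{ -1}m(n)}{a_1(n)}\bigg\}+1$$ is an integer-valued quasi-polynomial, where $a_1(n)^{ -1}$ is an inverse of $a_1(n)$ mod $a_2(n)$ and $a_2(n)^{ -1}$ is an inverse of $a_2(n)$ mod $a_1(n)$.
   Context: $\mathbb{N}$ is the set of natural numbers, and $\{y\}=y-[y]$ is the fractional part of a rational number $y$, where $[y]$ is the floor. An integer-valued quasi-polynomial is a function $f:\mathbb{N}\to\mathbb{Z}$ for which there exist positive integers $T,C$ and polynomials $f_i(x)\in\mathbb{Z}[x]$ ($i=0,1,\dots,T-1$) such that $f(n)=f_i(m)$ whenever $n>C$ and $n=Tm+i$ with $m\in\mathbb{N}$. The integer-valued quasi-polynomials form a commutative ring $R$ with identity under pointwise addition and multiplication. Positive leading coefficients means that the leading coefficient of every $f_i$ is positive. Write $f\succcurlyeq 0$ if each $f_i$ is zero or has positive leading coefficient. For $f,g\in R$ with $g(n)\neq0$ for every $n\in\mathbb{N}$, $g$ is a divisor of $f$, written $g\mid f$, if $g(n)$ divides $f(n)$ for every $n\in\mathbb{N}$. For $f_1,\dots,f_s\in R$, $\mathrm{ggcd}(f_1,\dots,f_s)$ is the unique greatest common divisor $d\in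 R$ with $d\succcurlyeq0$; here a greatest common divisor is a $d\in R$ such that $d\mid f_k$ for all $k$ and every $p\in R$ with $p\mid f_k$ for all $k$ satisfies $p\mid d$. If $\mathrm{ggcd}(a_1,a_2)=1$, there exist $u_1,u_2\in R$ with $a_1u_1+a_2u_2=1$; then $u_1$ is called an inverse of $a_1$ mod $a_2$ (denoted $a_1^{ -1}$) and $u_2$ an inverse of $a_2$ mod $a_1$ (denoted $a_2^{ -1}$). The function $p$ is defined by $p_{\{a_1(n),a_2(n)\}}(m(n))=\#\{(x_1,x_2)\in\mathbb{Z}^2:\text{ all }x_j\ge0,\ x_1a_1(n)+x_2a_2(n)=m(n)\}$.
   Formalization: The formula is asserted only at those n with a_1(n), a_2(n) > 0 and m(n) ≥ 0, and p is the solution count where a_1(n), a_2(n) > 0 (all large n); for m(n) < 0 the formula can fail, e.g. a_1 = a_2 = 1, m(n) = n − 5 at n = 0. -}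

module Defs where

open import Data.Bool.Base using (if_then_else_)
open import Data.Fin.Base using (Fin; toℕ)
open import Data.Integer.Base as ℤ using (ℤ; +_; +[1+_]; -[1+_]; 0ℤ; 1ℤ)
open import Data.Integer.Divisibility using (_∣_)
import Data.Integer.Properties as ℤ
open import Data.List.Base using (List; []; _∷_)
open import Data.List.Relation.Unary.All using (All)
open import Data.Nat.Base as ℕ using (ℕ; suc)
open import Data.Product.Base using (Σ-syntax; ∃-syntax; _×_; _,_)
open import Data.Rational.Base as ℚ using (ℚ; 1ℚ; floor)
open import Data.Sum.Base using (_⊎_)
open import Function.Bundles using (_↔_)
open import Relation.Binary.PropositionalEquality.Core using (_≡_; _≢_)
open import Relation.Nullary.Decidable.Core using (does)

-- Elements of ℤ[x]: coefficient lists, constant term first. Trailing zeros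
-- are allowed, so a polynomial is represented by more than one list.
Polynomial : Set
Polynomial = List ℤ

eval : Polynomial → ℤ → ℤ
eval []       x = 0ℤ
eval (c ∷ cs) x = c ℤ.+ x ℤ.* eval cs x

IsZero : Polynomial → Set
IsZero = All (_≡ 0ℤ)

-- The last nonzero entry of the list (0 for the zero polynomial).
leadingCoefficient : Polynomial → ℤ
leadingCoefficient []       = 0ℤ
leadingCoefficient (c ∷ cs) =
  if does (leadingCoefficient cs ℤ.≟ 0ℤ) then c else leadingCoefficient cs

record IsQuasiPolynomial (f : ℕ → ℤ) : Set where
  field
    T C         : ℕ
    {{T≢0}}     : ℕ.NonZero T
    {{C≢0}}     : ℕ.NonZero C
    constituent : Fin T → Polynomial
    agrees      : ∀ n m (i : Fin T) → n ℕ.> C → n ≡ T ℕ.* m ℕ.+ toℕ i →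
                  f n ≡ eval (constituent i) (+ m)

-- The next two predicates are read off from the given constituents. They do
-- not depend on that choice: by `agrees`, the sign of a leading coefficient is
-- the eventual sign of f on the corresponding residue class.
HasPositiveLeadingCoefficients : ∀ {f} → IsQuasiPolynomial f → Set
HasPositiveLeadingCoefficients F =
  ∀ i → 0ℤ ℤ.< leadingCoefficient (constituent i)
  where open IsQuasiPolynomial F

_≽0 : ∀ {f} → IsQuasiPolynomial f → Set
F ≽0 = ∀ i → IsZero (constituent i) ⊎ 0ℤ ℤ.< leadingCoefficient (constituent i)
  where open IsQuasiPolynomial F

infix 4 _∣ᴿ_

_∣ᴿ_ : (g f : ℕ → ℤ) → Set
g ∣ᴿ f = (∀ n → g n ≢ 0ℤ) × (∀ n → g n ∣ f n)

record IsGGCD (fs : List (ℕ → ℤ)) (d : ℕ → ℤ) : Set where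
  field
    quasiPolynomial : IsQuasiPolynomial d
    nonNegative     : quasiPolynomial ≽0
    divides         : All (d ∣ᴿ_) fs
    greatest        : ∀ p → IsQuasiPolynomial p → All (p ∣ᴿ_) fs → p ∣ᴿ d

IsInverse : (a b u : ℕ → ℤ) → Set
IsInverse a b u =
  IsQuasiPolynomial u ×
  ∃[ v ] (IsQuasiPolynomial v × (∀ n → a n ℤ.* u n ℤ.+ b n ℤ.* v n ≡ 1ℤ))

Solutions : (a b m : ℤ) → Set
Solutions a b m =
  Σ[ (x₁ , x₂) ∈ ℤ × ℤ ]
    (0ℤ ℤ.≤ x₁ × 0ℤ ℤ.≤ x₂ × x₁ ℤ.* a ℤ.+ x₂ ℤ.* b ≡ m)

_HasCardinality_ : Set → ℕ → Set
A HasCardinality k = A ↔ Fin k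

infixl 7 _÷_

_÷_ : (i j : ℤ) .{{_ : ℤ.NonZero j}} → ℚ
i ÷ +[1+ k ] = i ℚ./ suc k
i ÷ -[1+ k ] = (ℤ.- i) ℚ./ suc k

-- y - [y]; the library's fracPart truncates towards zero and returns the
-- absolute value, so it differs from this at negative y.
frac : ℚ → ℚ
frac y = y ℚ.- floor y ℚ./ 1

-- m/(ab) - {um/b} - {vm/a} + 1, where u = a⁻¹ mod b and v = b⁻¹ mod a.
countFormula : (a b u v m : ℤ) .{{_ : ℤ.NonZero a}} .{{_ : ℤ.NonZero b}} → ℚ
countFormula a b u v m =
  (m ÷ (a ℤ.* b)) {{ℤ.i*j≢0 a b}}
    ℚ.- frac ((u ℤ.* m) ÷ b)
    ℚ.- frac ((v ℤ.* m) ÷ a)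
    ℚ.+ 1ℚ

{-# OPTIONS --safe #-}

-- With a u + b v = 1, the solutions of x₁ a + x₂ b = m lie on the line
-- (u m - b t, v m + a t), so their number is ⌊u m / b⌋ + ⌊v m / a⌋ + 1 whenever
-- m ≥ 0, and m / (a b) = u m / b + v m / a turns this into the stated formula.
-- For quasi-polynomiality, on each residue class a and b are polynomials that
-- are coprime at every argument, hence without a common divisor of positive
-- degree; pseudo-division gives f U + g V = R for a constant R ≠ 0, and passing
-- to residue classes modulo R² turns U and V into integer polynomial inverses.
-- The floor of a quotient of polynomials is again a quasi-polynomial.
module Submission where

open import Defs
open import Algebra.Properties.AbelianGroup using (∙-cancelˡ; ∙-cancelʳ)
open import Axiom.UniquenessOfIdentityProofs using (module Decidable⇒UIP)
open import Data.Empty using (⊥; ⊥-elim)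
open import Data.Fin.Base using (Fin; toℕ; fromℕ<)
open import Data.Fin.Permutation using (↔⇒≡)
import Data.Fin.Properties as Fin
open import Data.Integer.Base hiding (suc; pred; _≥_; _>_; _/_)
open import Data.Integer.DivMod using (n%ℕd<d; a≡a%ℕn+[a/ℕn]*n; div-pos-is-/ℕ)
open import Data.Integer.GCD using (gcd)
open import Data.Integer.Properties
open import Data.Integer.Tactic.RingSolver using (solve-∀)
open import Data.List.Base using ([]; _∷_)
open import Data.List.Relation.Unary.All using ([]; _∷_)
open import Data.Nat.Base as ℕ using (ℕ; zero; suc)
import Data.Nat.Divisibility as ℕ
import Data.Nat.DivMod as ℕ
import Data.Nat.GCD as ℕ
import Data.Nat.Properties as ℕ
import Data.Nat.Tactic.RingSolver as ℕ
open import Data.Product.Base using (_×_; _,_; Σ-syntax; ∃-syntax; proj₁; proj₂)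
open import Data.Rational.Base as ℚ using (mkℚ; 1ℚ; _/_; ↥_; ↧_)
import Data.Rational.Properties as ℚ
open import Data.Rational.Solver using (module +-*-Solver)
open import Data.Rational.Unnormalised.Base as ℚᵘ using (mkℚᵘ; *≡*)
import Data.Rational.Unnormalised.Properties as ℚᵘ
open import Data.Sum.Base using (_⊎_; inj₁; inj₂)
open import Function.Bundles using (_↔_; mk↔ₛ′)
open import Function.Construct.Composition using (_↔-∘_)
open import Function.Construct.Symmetry using (↔-sym)
open import Relation.Binary.Definitions using (Tri; tri<; tri≈; tri>)
open import Relation.Binary.PropositionalEquality
open import Relation.Nullary using (yes; no)

-- Integer polynomial functions

-- Bézout coefficients chosen separately at each n follow no pattern in n, and the inverses in the
-- formula are arbitrary quasi-polynomials taken from two separate identities. These choices are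
-- never compared directly: the number of solutions is the cardinality of a fixed set, so it may be
-- defined from one choice and evaluated with any other. For inverses u and v from two identities, a
-- u + b v is 1 only modulo a b. The defect is an integer w with a u + b v + a b w = 1, and it adds
-- w m to the two floors. Positive leading coefficients leave finitely many n uncontrolled. Where a₁
-- or a₂ fails to be positive the solution set can be infinite, and where m is negative the formula
-- can be negative (a = b = 1, m = -5 gives -4); hence the pointwise sign conditions in the theorem.
-- Quasi-polynomiality does not see these n. Polynomials are handled as functions ℤ → ℤ, so that
-- every identity between them is an identity of integers at one argument.

record IsPoly (f : ℤ → ℤ) : Set where
  constructor poly
  field
    list  : Polynomial
    evals : ∀ x → f x ≡ eval list x

poly-ext : ∀ {f g} → (∀ x → g x ≡ f x) → IsPoly f → IsPoly g
poly-ext eq (poly P e) = poly P λ x → trans (eq x) (e x)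

poly-const : ∀ c → IsPoly (λ _ → c)
poly-const c = poly (c ∷ []) λ x → lem c x
  where
  lem : ∀ c x → c ≡ c + x * 0ℤ
  lem = solve-∀

poly-id : IsPoly (λ x → x)
poly-id = poly (0ℤ ∷ 1ℤ ∷ []) lem
  where
  lem : ∀ x → x ≡ 0ℤ + x * (1ℤ + x * 0ℤ)
  lem = solve-∀

poly-+ : ∀ {f g} → IsPoly f → IsPoly g → IsPoly (λ x → f x + g x)
poly-+ (poly P e) (poly Q e′) =
  poly (add P Q) λ x → trans (cong₂ _+_ (e x) (e′ x)) (eval-add P Q x)
  where
  add : Polynomial → Polynomial → Polynomial
  add []      Q       = Q
  add (c ∷ P) []      = c ∷ P
  add (c ∷ P) (d ∷ Q) = c + d ∷ add P Q

  regroup : ∀ c d x p q → (c + x * p) + (d + x * q) ≡ (c + d) + x * (p + q)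
  regroup = solve-∀

  eval-add : ∀ P Q x → eval P x + eval Q x ≡ eval (add P Q) x
  eval-add []      Q       x = +-identityˡ _
  eval-add (c ∷ P) []      x = +-identityʳ _
  eval-add (c ∷ P) (d ∷ Q) x =
    trans (regroup c d x (eval P x) (eval Q x))
          (cong (λ y → (c + d) + x * y) (eval-add P Q x))

poly-scale : ∀ {f} c → IsPoly f → IsPoly (λ x → c * f x)
poly-scale {f} c (poly P e) = poly (scale P) λ x → trans (cong (c *_) (e x)) (eval-scale P x)
  where
  scale : Polynomial → Polynomial
  scale []      = []
  scale (d ∷ P) = c * d ∷ scale P

  regroup : ∀ c d x p → c * (d + x * p) ≡ c * d + x * (c * p)
  regroup = solve-∀

  eval-scale : ∀ P x → c * eval P x ≡ eval (scale P) x
  eval-scale []      x = *-zeroʳ c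
  eval-scale (d ∷ P) x =
    trans (regroup c d x (eval P x)) (cong (λ y → c * d + x * y) (eval-scale P x))

poly-shift : ∀ {f} → IsPoly f → IsPoly (λ x → x * f x)
poly-shift (poly P e) = poly (0ℤ ∷ P) λ x → trans (cong (x *_) (e x)) (sym (+-identityˡ _))

poly-* : ∀ {f g} → IsPoly f → IsPoly g → IsPoly (λ x → f x * g x)
poly-* {f} {g} (poly P e) G = poly-ext (λ x → cong (_* g x) (e x)) (go P)
  where
  regroup : ∀ c x p q → (c + x * p) * q ≡ c * q + x * (p * q)
  regroup = solve-∀

  go : ∀ P → IsPoly (λ x → eval P x * g x)
  go []      = poly-const 0ℤ
  go (c ∷ P) = poly-ext (λ x → regroup c x (eval P x) (g x))
                         (poly-+ (poly-scale c G) (poly-shift (go P)))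

poly-neg : ∀ {f} → IsPoly f → IsPoly (λ x → - f x)
poly-neg F = poly-ext (λ x → sym (-1*i≡-i _)) (poly-scale -1ℤ F)

poly-- : ∀ {f g} → IsPoly f → IsPoly g → IsPoly (λ x → f x - g x)
poly-- F G = poly-+ F (poly-neg G)

poly-^ : ∀ {f} n → IsPoly f → IsPoly (λ x → f x ^ n)
poly-^ zero    F = poly-const 1ℤ
poly-^ (suc n) F = poly-* F (poly-^ n F)

poly-∘ : ∀ {f g} → IsPoly f → IsPoly g → IsPoly (λ x → f (g x))
poly-∘ {f} {g} (poly P e) G = poly-ext (λ x → e (g x)) (go P)
  where
  go : ∀ P → IsPoly (λ x → eval P (g x))
  go []      = poly-const 0ℤ
  go (c ∷ P) = poly-+ (poly-const c) (poly-* G (go P))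

poly-affine : ∀ {f} → IsPoly f → ∀ a b → IsPoly (λ x → f (a * x + b))
poly-affine F a b = poly-∘ F (poly-+ (poly-scale a poly-id) (poly-const b))

-- Horner's rule preserves congruence modulo L, and its quotient stays an integer polynomial in x.
-- Integrality of `w` is what later keeps inverses and floors inside ℤ[x] on a residue class.
poly-mod : ∀ {f} → IsPoly f → ∀ L r →
  Σ[ w ∈ (ℤ → ℤ) ] IsPoly w × (∀ x → f (L * x + r) ≡ f r + L * w x)
poly-mod {f} (poly P e) L r with go P
  where
  regroup : ∀ c L x r p w →
    c + (L * x + r) * (p + L * w) ≡ (c + r * p) + L * (x * (p + L * w) + r * w)
  regroup = solve-∀

  zeros : ∀ L → 0ℤ ≡ 0ℤ + L * 0ℤ
  zeros = solve-∀

  go : ∀ P → Σ[ w ∈ (ℤ → ℤ) ] IsPoly w ×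
         (∀ x → eval P (L * x + r) ≡ eval P r + L * w x)
  go []      = (λ _ → 0ℤ) , poly-const 0ℤ , λ x → zeros L
  go (c ∷ P) with w , W , eq ← go P =
    (λ x → x * (eval P r + L * w x) + r * w x) ,
    poly-+ (poly-shift (poly-+ (poly-const (eval P r)) (poly-scale L W))) (poly-scale r W) ,
    λ x → trans (cong (λ y → c + (L * x + r) * y) (eq x)) (regroup c L x r (eval P r) (w x))
... | w , W , eq = w , W , λ x →
  trans (e (L * x + r)) (trans (eq x) (cong (_+ L * w x) (sym (e r))))

-- Degree bounds, leading terms and pseudo-division

-- The top coefficient may be 0, so this is a bound and not a degree: linear combinations keep the
-- index even when leading terms cancel, and recursion on the index drives the Euclidean algorithm.
data Deg< : ℕ → (ℤ → ℤ) → Set where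
  none : ∀ {f} → (∀ x → f x ≡ 0ℤ) → Deg< zero f
  top  : ∀ {d f g} c → Deg< d g → (∀ x → f x ≡ c * x ^ d + g x) → Deg< (suc d) f

record Lead (d : ℕ) (q : ℤ) (f : ℤ → ℤ) : Set where
  constructor lead
  field
    {lower} : ℤ → ℤ
    deg     : Deg< d lower
    splits  : ∀ x → f x ≡ q * x ^ d + lower x

deg-zero : ∀ d → Deg< d (λ _ → 0ℤ)
deg-zero zero    = none λ _ → refl
deg-zero (suc d) = top 0ℤ (deg-zero d) λ x → refl

deg-horner : ∀ {d f} c → Deg< d f → Deg< (suc d) (λ x → c + x * f x)
deg-horner {f = f} c (none eq) =
  top c (none λ _ → refl) λ x → trans (cong (λ y → c + x * y) (eq x)) (lem c x)
  where
  lem : ∀ c x → c + x * 0ℤ ≡ c * 1ℤ + 0ℤ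
  lem = solve-∀
deg-horner c (top {d} {g = g} e D eq) =
  top e (deg-horner c D) λ x →
    trans (cong (λ y → c + x * y) (eq x)) (lem c x e (x ^ d) (g x))
  where
  lem : ∀ c x e p g → c + x * (e * p + g) ≡ e * (x * p) + (c + x * g)
  lem = solve-∀

deg-combination : ∀ {d f g} a b → Deg< d f → Deg< d g → Deg< d (λ x → a * f x + b * g x)
deg-combination a b (none eq) (none eq′) =
  none λ x → trans (cong₂ (λ y z → a * y + b * z) (eq x) (eq′ x)) (lem a b)
  where
  lem : ∀ a b → a * 0ℤ + b * 0ℤ ≡ 0ℤ
  lem = solve-∀
deg-combination a b (top {d} {g = h} c D eq) (top {g = h′} c′ D′ eq′) =
  top (a * c + b * c′) (deg-combination a b D D′) λ x →
    trans (cong₂ (λ y z → a * y + b * z) (eq x) (eq′ x)) (lem a b c c′ (x ^ d) (h x) (h′ x))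
  where
  lem : ∀ a b c c′ p y z →
    a * (c * p + y) + b * (c′ * p + z) ≡ (a * c + b * c′) * p + (a * y + b * z)
  lem = solve-∀

deg-ext : ∀ {d f g} → (∀ x → g x ≡ f x) → Deg< d f → Deg< d g
deg-ext eq (none e)    = none λ x → trans (eq x) (e x)
deg-ext eq (top c D e) = top c D λ x → trans (eq x) (e x)

deg⇒poly : ∀ {d f} → Deg< d f → IsPoly f
deg⇒poly (none eq)        = poly-ext eq (poly-const 0ℤ)
deg⇒poly (top {d} c D eq) =
  poly-ext eq (poly-+ (poly-scale c (poly-^ d poly-id)) (deg⇒poly D))

poly⇒deg : ∀ {f} → IsPoly f → ∃[ d ] Deg< d f
poly⇒deg (poly P e) with go P
  where
  go : ∀ P → ∃[ d ] Deg< d (eval P)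
  go []      = zero , none λ _ → refl
  go (c ∷ P) with d , D ← go P = suc d , deg-horner c D
... | d , D = d , deg-ext e D

lead⇒poly : ∀ {d q f} → Lead d q f → IsPoly f
lead⇒poly {q = q} (lead D eq) = deg⇒poly (top q D eq)

leadingCoefficient-lead : ∀ P →
  (leadingCoefficient P ≡ 0ℤ × (∀ x → eval P x ≡ 0ℤ)) ⊎
  (leadingCoefficient P ≢ 0ℤ × ∃[ d ] Lead d (leadingCoefficient P) (eval P))
leadingCoefficient-lead []      = inj₁ (refl , λ _ → refl)
leadingCoefficient-lead (c ∷ P) with leadingCoefficient P ≟ 0ℤ | leadingCoefficient-lead P
... | yes l≡0 | inj₂ (l≢0 , _)      = ⊥-elim (l≢0 l≡0)
... | no  l≢0 | inj₁ (l≡0 , _)      = ⊥-elim (l≢0 l≡0)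
... | no  l≢0 | inj₂ (_ , d , lead {g} D eq) =
  inj₂ (l≢0 , suc d , lead (deg-horner c D) λ x →
    trans (cong (λ y → c + x * y) (eq x)) (lem c x (leadingCoefficient P) (x ^ d) (g x)))
  where
  lem : ∀ c x e p g → c + x * (e * p + g) ≡ e * (x * p) + (c + x * g)
  lem = solve-∀
... | yes l≡0 | inj₁ (_ , ev≡0) with c ≟ 0ℤ
...   | yes refl = inj₁ (refl , vanish)
  where
  vanish : ∀ x → 0ℤ + x * eval P x ≡ 0ℤ
  vanish x = trans (cong (λ y → 0ℤ + x * y) (ev≡0 x)) (cong (λ y → 0ℤ + y) (*-zeroʳ x))
...   | no  c≢0  = inj₂ (c≢0 , zero , lead (none λ _ → refl) λ x →
    trans (cong (λ y → c + x * y) (ev≡0 x)) (lem c x))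
  where
  lem : ∀ c x → c + x * 0ℤ ≡ c * 1ℤ + 0ℤ
  lem = solve-∀

zero⊎lead : ∀ {f} → IsPoly f → (∀ x → f x ≡ 0ℤ) ⊎ ∃[ d ] ∃[ q ] (q ≢ 0ℤ × Lead d q f)
zero⊎lead (poly P e) with leadingCoefficient-lead P
... | inj₁ (_ , z)               = inj₁ λ x → trans (e x) (z x)
... | inj₂ (q≢0 , d , lead D eq) = inj₂ (d , _ , q≢0 , lead D λ x → trans (e x) (eq x))

record PseudoDivision (q : ℤ) (d : ℕ) (f g : ℤ → ℤ) : Set where
  field
    exponent           : ℕ
    quotient remainder : ℤ → ℤ
    quotient-poly      : IsPoly quotient
    remainder-deg      : Deg< d remainder
    division           : ∀ x → q ^ exponent * f x ≡ g x * quotient x + remainder x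

-- The recursion runs over the coefficient list of the dividend, so each step has a single excess
-- term of degree d to cancel. Each coefficient costs one factor `q`, which replaces division by the
-- leading coefficient.
pseudoDivide : ∀ {d q f g} → IsPoly f → Lead d q g → PseudoDivision q d f g
pseudoDivide {d} {q} {f} {g} (poly P e) (lead {g₀} G g-eq) =
  let open PseudoDivision (go P) in record
    { exponent = exponent ; quotient-poly = quotient-poly ; remainder-deg = remainder-deg
    ; division = λ x → trans (cong (q ^ exponent *_) (e x)) (division x) }
  where
  zeros : ∀ q g → q * 0ℤ ≡ g * 0ℤ + 0ℤ
  zeros = solve-∀

  -- The remainder c′ + x r of the Horner step has degree at most d; its top
  -- coefficient t is cancelled by multiplying with q and subtracting t g.
  step : ∀ q qⁿ c x p s r t xᵈ h g₀ →
    qⁿ * p ≡ (q * xᵈ + g₀) * s + r →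
    qⁿ * c + x * r ≡ t * xᵈ + h →
    (q * qⁿ) * (c + x * p) ≡ (q * xᵈ + g₀) * (q * (x * s) + t) + (q * h + (- t) * g₀)
  step q qⁿ c x p s r t xᵈ h g₀ eq₁ eq₂ =
    trans (a₁ q qⁿ c x p)
    (trans (cong (λ y → q * (qⁿ * c + x * y)) eq₁)
    (trans (a₂ q (qⁿ * c) x ((q * xᵈ + g₀) * s) r)
    (trans (cong (λ y → q * (x * ((q * xᵈ + g₀) * s) + y)) eq₂)
           (a₃ q x s t xᵈ h g₀))))
    where
    a₁ : ∀ q qⁿ c x p → (q * qⁿ) * (c + x * p) ≡ q * (qⁿ * c + x * (qⁿ * p))
    a₁ = solve-∀
    a₂ : ∀ q c x y r → q * (c + x * (y + r)) ≡ q * (x * y + (c + x * r))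
    a₂ = solve-∀
    a₃ : ∀ q x s t xᵈ h g₀ →
      q * (x * ((q * xᵈ + g₀) * s) + (t * xᵈ + h)) ≡
      (q * xᵈ + g₀) * (q * (x * s) + t) + (q * h + (- t) * g₀)
    a₃ = solve-∀

  go : ∀ P → PseudoDivision q d (eval P) g
  go [] = record
    { exponent = 0 ; quotient-poly = poly-const 0ℤ ; remainder-deg = deg-zero d
    ; division = λ x → zeros 1ℤ (g x) }
  go (c ∷ P) = result
    where
    open PseudoDivision (go P)
    result : PseudoDivision q d (eval (c ∷ P)) g
    result with top {g = h} t H eq ← deg-horner (q ^ exponent * c) remainder-deg = record
      { exponent      = suc exponent
      ; quotient-poly = poly-+ (poly-scale q (poly-shift quotient-poly)) (poly-const t)
      ; remainder-deg = deg-combination q (- t) H G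
      ; division      = λ x → trans
          (step q (q ^ exponent) c x (eval P x) (quotient x) (remainder x) t (x ^ d) (h x) (g₀ x)
            (trans (division x) (cong (λ y → y * quotient x + remainder x) (g-eq x))) (eq x))
          (cong (λ y → y * (q * (x * quotient x) + t) + (q * h x + (- t) * g₀ x))
                (sym (g-eq x)))
      }

-- Growth and sign of polynomials

i<j⇒0<j-i : ∀ {i j} → i < j → 0ℤ < j - i
i<j⇒0<j-i {i} {j} i<j = subst (_< j - i) (+-inverseʳ i) (+-monoˡ-< (- i) i<j)

0<j-i⇒i<j : ∀ {i j} → 0ℤ < j - i → i < j
0<j-i⇒i<j {i} {j} 0<j-i = subst₂ _<_ (+-identityˡ i) (lem j i) (+-monoˡ-< i 0<j-i)
  where
  lem : ∀ j i → j - i + i ≡ j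
  lem = solve-∀

i<j⇒i<∣j∣ : ∀ {n j} → + n < j → n ℕ.< ∣ j ∣
i<j⇒i<∣j∣ {j = + _} n<j = drop‿+<+ n<j

0<i*j : ∀ {i j} → 0ℤ < i → 0ℤ < j → 0ℤ < i * j
0<i*j {i} {j} 0<i 0<j =
  subst (_< i * j) (*-zeroʳ i) (*-monoˡ-<-pos i {{positive 0<i}} 0<j)

0≤i*j : ∀ {i j} → 0ℤ ≤ i → 0ℤ ≤ j → 0ℤ ≤ i * j
0≤i*j {i} {j} 0≤i 0≤j =
  subst (_≤ i * j) (*-zeroʳ i) (*-monoˡ-≤-nonNeg i {{nonNegative 0≤i}} 0≤j)

record Eventually (P : ℕ → Set) : Set where
  constructor eventually
  field
    bound : ℕ
    holds : ∀ k → bound ℕ.≤ k → P k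

ev-always : ∀ {P} → (∀ k → P k) → Eventually P
ev-always p = eventually 0 λ k _ → p k

ev-map : ∀ {P Q} → (∀ k → P k → Q k) → Eventually P → Eventually Q
ev-map f (eventually C p) = eventually C λ k C≤k → f k (p k C≤k)

ev-zip : ∀ {P Q R} → (∀ k → P k → Q k → R k) → Eventually P → Eventually Q → Eventually R
ev-zip f (eventually C p) (eventually C′ q) = eventually (C ℕ.⊔ C′) λ k C≤k →
  f k (p k (ℕ.≤-trans (ℕ.m≤m⊔n C C′) C≤k)) (q k (ℕ.≤-trans (ℕ.m≤n⊔m C C′) C≤k))

ev-sample : ∀ {P} → Eventually P → ∃[ k ] P k
ev-sample (eventually C p) = C , p C ℕ.≤-refl

ev-subsequence : ∀ {P} (h : ℕ → ℕ) → (∀ k → k ℕ.≤ h k) → Eventually P → Eventually (λ k → P (h k))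
ev-subsequence h k≤h (eventually C p) = eventually C λ k C≤k → p (h k) (ℕ.≤-trans C≤k (k≤h k))

k≤L*k+r : ∀ L r k .{{_ : ℕ.NonZero L}} → k ℕ.≤ L ℕ.* k ℕ.+ r
k≤L*k+r L r k = ℕ.≤-trans (ℕ.m≤n*m k L) (ℕ.m≤m+n _ r)

pos-affine : ∀ L r k → + (L ℕ.* k ℕ.+ r) ≡ + L * + k + + r
pos-affine L r k = trans (pos-+ (L ℕ.* k) r) (cong (_+ + r) (pos-* L k))

pos-^ : ∀ k d → (+ k) ^ d ≡ + (k ℕ.^ d)
pos-^ k zero    = refl
pos-^ k (suc d) = trans (cong (+ k *_) (pos-^ k d)) (sym (pos-* k (k ℕ.^ d)))

-- The top term and the induction hypothesis together give the factor |c| + 1, which one more power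
-- of k absorbs as soon as k > |c|.
deg-growth : ∀ {d f} → Deg< d f → Eventually (λ k → ∣ f (+ k) ∣ ℕ.< k ℕ.^ d)
deg-growth (none eq) = ev-always λ k → ℕ.≤-reflexive (cong (λ y → suc ∣ y ∣) (eq (+ k)))
deg-growth (top {d} {f} {g} c D eq) =
  ev-zip step (deg-growth D) (eventually (suc ∣ c ∣) λ k le → le)
  where
  open ℕ.≤-Reasoning
  step : ∀ k → ∣ g (+ k) ∣ ℕ.< k ℕ.^ d → suc ∣ c ∣ ℕ.≤ k → ∣ f (+ k) ∣ ℕ.< k ℕ.* k ℕ.^ d
  step k small large = begin-strict
    ∣ f (+ k) ∣                                  ≡⟨ cong ∣_∣ (eq (+ k)) ⟩
    ∣ c * (+ k) ^ d + g (+ k) ∣                  ≤⟨ ∣i+j∣≤∣i∣+∣j∣ (c * (+ k) ^ d) (g (+ k)) ⟩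
    ∣ c * (+ k) ^ d ∣ ℕ.+ ∣ g (+ k) ∣            ≡⟨ cong (ℕ._+ ∣ g (+ k) ∣) (abs-* c _) ⟩
    ∣ c ∣ ℕ.* ∣ (+ k) ^ d ∣ ℕ.+ ∣ g (+ k) ∣      ≡⟨ cong (λ y → ∣ c ∣ ℕ.* ∣ y ∣ ℕ.+ ∣ g (+ k) ∣) (pos-^ k d) ⟩
    ∣ c ∣ ℕ.* k ℕ.^ d ℕ.+ ∣ g (+ k) ∣            <⟨ ℕ.+-monoʳ-< (∣ c ∣ ℕ.* k ℕ.^ d) small ⟩
    ∣ c ∣ ℕ.* k ℕ.^ d ℕ.+ k ℕ.^ d                ≡⟨ ℕ.+-comm _ (k ℕ.^ d) ⟩
    suc ∣ c ∣ ℕ.* k ℕ.^ d                        ≤⟨ ℕ.*-monoˡ-≤ (k ℕ.^ d) large ⟩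
    k ℕ.* k ℕ.^ d                                ∎

∣i∣<n⇒0<n+i : ∀ {n} i → ∣ i ∣ ℕ.< n → 0ℤ < + n + i
∣i∣<n⇒0<n+i {n} (+ m)    m<n = +<+ (ℕ.<-≤-trans (ℕ.≤-<-trans ℕ.z≤n m<n) (ℕ.m≤m+n n m))
∣i∣<n⇒0<n+i {n} -[1+ m ] m<n =
  subst (0ℤ <_) (sym (⊖-≥ (ℕ.<⇒≤ m<n))) (+<+ (ℕ.m<n⇒0<n∸m m<n))

lead-positive : ∀ {d q f} → 0ℤ < q → Lead d q f → Eventually (λ k → 0ℤ < f (+ k))
lead-positive {d} {+[1+ j ]} {f} _ (lead {g} D eq) = ev-map step (deg-growth D)
  where
  step : ∀ k → ∣ g (+ k) ∣ ℕ.< k ℕ.^ d → 0ℤ < f (+ k)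
  step k small = subst (0ℤ <_) (sym (trans (eq (+ k)) (cong (_+ g (+ k)) q*x^d)))
    (∣i∣<n⇒0<n+i (g (+ k)) (ℕ.<-≤-trans small (ℕ.m≤m+n (k ℕ.^ d) (j ℕ.* k ℕ.^ d))))
    where
    q*x^d : +[1+ j ] * (+ k) ^ d ≡ + (suc j ℕ.* k ℕ.^ d)
    q*x^d = trans (cong (+[1+ j ] *_) (pos-^ k d)) (sym (pos-* (suc j) (k ℕ.^ d)))
lead-positive {q = +0} (+<+ ())

lead-neg : ∀ {d q f} → Lead d q f → Lead d (- q) (λ x → - f x)
lead-neg {d} {q} (lead {g} D eq) = lead (deg-combination -1ℤ 0ℤ D D) λ x →
  trans (cong -_ (eq x)) (lem q (x ^ d) (g x))
  where
  lem : ∀ q p g → - (q * p + g) ≡ (- q) * p + (-1ℤ * g + 0ℤ * g)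
  lem = solve-∀

lead-add : ∀ {d q f g} → Lead d q f → Deg< d g → ∀ c → Lead d q (λ x → f x + c * g x)
lead-add {d} {q} {g = g} (lead {f₀} D eq) E c = lead (deg-combination 1ℤ c D E) λ x →
  trans (cong (_+ c * g x) (eq x)) (lem q (x ^ d) (f₀ x) c (g x))
  where
  lem : ∀ q p f c g → q * p + f + c * g ≡ q * p + (1ℤ * f + c * g)
  lem = solve-∀

deg-const : ∀ d c → Deg< (suc d) (λ _ → c)
deg-const d c = deg-ext (λ x → lem c x) (deg-horner c (deg-zero d))
  where
  lem : ∀ c x → c ≡ c + x * 0ℤ
  lem = solve-∀

neg-positive : ∀ {i} → 0ℤ < - i → i < 0ℤ
neg-positive {i} 0<-i = subst (_< 0ℤ) (neg-involutive i) (neg-mono-< 0<-i)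

poly-sign : ∀ {f} → IsPoly f →
  Eventually (λ k → 0ℤ ≤ f (+ k)) ⊎ Eventually (λ k → f (+ k) < 0ℤ)
poly-sign F with zero⊎lead F
... | inj₁ f≡0 = inj₁ (ev-always λ k → ≤-reflexive (sym (f≡0 (+ k))))
... | inj₂ (d , q , q≢0 , l) with <-cmp 0ℤ q
...   | tri< 0<q _ _ = inj₁ (ev-map (λ k → <⇒≤) (lead-positive 0<q l))
...   | tri≈ _ 0≡q _ = ⊥-elim (q≢0 (sym 0≡q))
...   | tri> _ _ q<0 = inj₂ (ev-map (λ k → neg-positive) (lead-positive (neg-mono-< q<0) (lead-neg l)))

-- Denominators are known to be positive only through their values, whereas pseudo-division needs a
-- leading term; one sampled value rules out the other signs.
positive⇒lead : ∀ {f} → IsPoly f → Eventually (λ k → 0ℤ < f (+ k)) →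
  ∃[ d ] ∃[ q ] (0ℤ < q × Lead d q f)
positive⇒lead F pos with zero⊎lead F
... | inj₁ f≡0 with k , fk>0 ← ev-sample pos = ⊥-elim (<-irrefl (sym (f≡0 (+ k))) fk>0)
... | inj₂ (d , q , q≢0 , l) with <-cmp 0ℤ q
...   | tri< 0<q _ _ = d , q , 0<q , l
...   | tri≈ _ 0≡q _ = ⊥-elim (q≢0 (sym 0≡q))
...   | tri> _ _ q<0
  with k , fk>0 , -fk>0 ← ev-sample (ev-zip (λ _ → _,_) pos
                            (lead-positive (neg-mono-< q<0) (lead-neg l))) =
  ⊥-elim (<-asym fk>0 (neg-positive -fk>0))

-- In positive degree, subtracting the constant B leaves the leading term alone, so f - B or - f - B
-- is eventually positive, according to the sign of `q`.
lead-unbounded : ∀ {d q f} → q ≢ 0ℤ → Lead (suc d) q f → ∀ B → Eventually (λ k → B ℕ.< ∣ f (+ k) ∣)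
lead-unbounded {d} {q} {f} q≢0 l B = by-sign (<-cmp 0ℤ q)
  where
  large : ∀ j → 0ℤ < j + (- + B) * 1ℤ → B ℕ.< ∣ j ∣
  large j pos =
    i<j⇒i<∣j∣ (0<j-i⇒i<j {+ B} {j} (subst (λ y → 0ℤ < j + y) (*-identityʳ (- + B)) pos))

  by-sign : Tri (0ℤ < q) (0ℤ ≡ q) (q < 0ℤ) → Eventually (λ k → B ℕ.< ∣ f (+ k) ∣)
  by-sign (tri≈ _ 0≡q _) = ⊥-elim (q≢0 (sym 0≡q))
  by-sign (tri< 0<q _ _) =
    ev-map (λ k pos → large (f (+ k)) pos)
      (lead-positive 0<q (lead-add l (deg-const d 1ℤ) (- + B)))
  by-sign (tri> _ _ q<0) =
    ev-map (λ k pos → subst (B ℕ.<_) (∣-i∣≡∣i∣ (f (+ k))) (large (- f (+ k)) pos))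
      (lead-positive (neg-mono-< q<0) (lead-add (lead-neg l) (deg-const d 1ℤ) (- + B)))

-- Bézout identities for polynomials

*-≢0 : ∀ {i j} → i ≢ 0ℤ → j ≢ 0ℤ → i * j ≢ 0ℤ
*-≢0 {i} i≢0 j≢0 i*j≡0 with i*j≡0⇒i≡0∨j≡0 i i*j≡0
... | inj₁ i≡0 = i≢0 i≡0
... | inj₂ j≡0 = j≢0 j≡0

-- Over ℤ the Euclidean algorithm only reaches a common divisor up to the
-- nonzero constants c and c′.
record PseudoGCD (f g : ℤ → ℤ) : Set where
  field
    D U V f′ g′ : ℤ → ℤ
    D-poly      : IsPoly D
    U-poly      : IsPoly U
    V-poly      : IsPoly V
    c c′        : ℤ
    c≢0         : c ≢ 0ℤ
    c′≢0        : c′ ≢ 0ℤ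
    bezout      : ∀ x → f x * U x + g x * V x ≡ D x
    divides₁    : ∀ x → c * f x ≡ D x * f′ x
    divides₂    : ∀ x → c′ * g x ≡ D x * g′ x

pseudoGCD : ∀ {d f g} → IsPoly f → Deg< d g → PseudoGCD f g
pseudoGCD {f = f} {g} F (none g≡0) = record
  { D = f ; U = λ _ → 1ℤ ; V = λ _ → 0ℤ ; f′ = λ _ → 1ℤ ; g′ = λ _ → 0ℤ
  ; D-poly = F ; U-poly = poly-const 1ℤ ; V-poly = poly-const 0ℤ
  ; c = 1ℤ ; c′ = 1ℤ ; c≢0 = λ () ; c′≢0 = λ ()
  ; bezout   = λ x → lem (f x) (g x)
  ; divides₁ = λ x → *-comm 1ℤ (f x)
  ; divides₂ = λ x → trans (cong (1ℤ *_) (g≡0 x)) (sym (*-zeroʳ (f x)))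
  }
  where
  lem : ∀ f g → f * 1ℤ + g * 0ℤ ≡ f
  lem = solve-∀
pseudoGCD {f = f} {g} F (top {d} {g = g₀} q G₀ eq) with q ≟ 0ℤ
... | yes refl = record
  { D-poly = D-poly ; U-poly = U-poly ; V-poly = V-poly ; c≢0 = c≢0 ; c′≢0 = c′≢0
  ; bezout   = λ x → trans (cong (λ y → f x * U x + y * V x) (g≡g₀ x)) (bezout x)
  ; divides₁ = divides₁
  ; divides₂ = λ x → trans (cong (c′ *_) (g≡g₀ x)) (divides₂ x)
  }
  where
  open PseudoGCD (pseudoGCD F G₀)
  g≡g₀ : ∀ x → g x ≡ g₀ x
  g≡g₀ x = trans (eq x) (+-identityˡ (g₀ x))
-- The recursive call is on `g` and the remainder r, so its `c`, `f′` belong to `g` and its `c′`,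
-- `g′` to r. Multiplying L f = g s + r by c c′ gives c c′ L f = c′ s (c g) + c (c′ r), a multiple
-- of `D`.
... | no q≢0 = record
  { D-poly = D-poly
  ; U-poly = poly-scale L V-poly
  ; V-poly = poly-- U-poly (poly-* quotient-poly V-poly)
  ; f′     = λ x → c′ * (quotient x * f′ x) + c * g′ x
  ; g′     = f′
  ; c      = c * c′ * L ; c′ = c
  ; c≢0    = *-≢0 (*-≢0 c≢0 c′≢0) (λ L≡0 → q≢0 (i^n≡0⇒i≡0 q exponent L≡0)) ; c′≢0 = c≢0
  ; bezout = λ x → trans (regroup (f x) L (V x) (g x) (U x) (quotient x))
      (trans (cong (λ y → g x * U x + (y - g x * quotient x) * V x) (division x))
      (trans (cancel (g x * U x) (g x * quotient x) (remainder x) (V x)) (bezout x)))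
  ; divides₁ = λ x → combine c c′ L (f x) (D x) (g x) (quotient x) (remainder x) (f′ x) (g′ x)
      (division x) (divides₁ x) (divides₂ x)
  ; divides₂ = divides₁
  }
  where
  open PseudoDivision (pseudoDivide F (lead {q = q} G₀ eq))
  open PseudoGCD (pseudoGCD (lead⇒poly (lead {q = q} G₀ eq)) remainder-deg)
  L : ℤ
  L = q ^ exponent
  regroup : ∀ f L V g U s → f * (L * V) + g * (U - s * V) ≡ g * U + (L * f - g * s) * V
  regroup = solve-∀
  cancel : ∀ a b r V → a + (b + r - b) * V ≡ a + r * V
  cancel = solve-∀
  combine : ∀ c c′ L f D g s r f′ g′ →
    L * f ≡ g * s + r → c * g ≡ D * f′ → c′ * r ≡ D * g′ →
    c * c′ * L * f ≡ D * (c′ * (s * f′) + c * g′)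
  combine c c′ L f D g s r f′ g′ eq₀ eq₁ eq₂ =
    trans (a₁ c c′ L f) (trans (cong (λ y → c * c′ * y) eq₀)
    (trans (a₂ c c′ g s r) (trans (cong₂ (λ y z → c′ * s * y + c * z) eq₁ eq₂)
    (a₃ c c′ D s f′ g′))))
    where
    a₁ : ∀ c c′ L f → c * c′ * L * f ≡ c * c′ * (L * f)
    a₁ = solve-∀
    a₂ : ∀ c c′ g s r → c * c′ * (g * s + r) ≡ c′ * s * (c * g) + c * (c′ * r)
    a₂ = solve-∀
    a₃ : ∀ c c′ D s f′ g′ → c′ * s * (D * f′) + c * (D * g′) ≡ D * (c′ * (s * f′) + c * g′)
    a₃ = solve-∀

record Coprime (a b : ℤ) : Set where
  constructor coprime
  field
    {u v}  : ℤ
    bezout : a * u + b * v ≡ 1ℤ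

∣-bound : ∀ i j {k} → i * j ≡ k → k ≢ 0ℤ → ∣ i ∣ ℕ.≤ ∣ k ∣
∣-bound i j i*j≡k k≢0 = ℕ.∣⇒≤ {{≢-nonZero k≢0}}
  (ℕ.divides ∣ j ∣ (trans (cong ∣_∣ (sym i*j≡k)) (trans (abs-* i j) (ℕ.*-comm ∣ i ∣ ∣ j ∣))))

-- A common divisor of positive degree would take arbitrarily large values,
-- all of them dividing c c′.
poly-bezout : ∀ {f g} → IsPoly f → IsPoly g → Eventually (λ k → Coprime (f (+ k)) (g (+ k))) →
  ∃[ R ] (R ≢ 0ℤ × Σ[ U ∈ (ℤ → ℤ) ] Σ[ V ∈ (ℤ → ℤ) ] IsPoly U × IsPoly V ×
    (∀ x → f x * U x + g x * V x ≡ R))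
poly-bezout {f} {g} F G cop = constant (zero⊎lead D-poly)
  where
  open PseudoGCD (pseudoGCD F (proj₂ (poly⇒deg G)))

  -- Multiply f u + g v = 1 by c c′ and replace c f and c′ g by their multiples of `D`.
  D∣cc′ : ∀ x → Coprime (f x) (g x) → ∃[ z ] D x * z ≡ c * c′
  D∣cc′ x (coprime {u} {v} eq) = c′ * (f′ x * u) + c * (g′ x * v) ,
    trans (a₁ (D x) c c′ (f′ x) (g′ x) u v)
    (trans (cong₂ (λ y z → c′ * (y * u) + c * (z * v)) (sym (divides₁ x)) (sym (divides₂ x)))
    (trans (a₂ c c′ (f x) (g x) u v) (trans (cong (c * c′ *_) eq) (*-identityʳ _))))
    where
    a₁ : ∀ D c c′ f′ g′ u v →
      D * (c′ * (f′ * u) + c * (g′ * v)) ≡ c′ * ((D * f′) * u) + c * ((D * g′) * v)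
    a₁ = solve-∀
    a₂ : ∀ c c′ f g u v → c′ * (c * f * u) + c * (c′ * g * v) ≡ c * c′ * (f * u + g * v)
    a₂ = solve-∀

  cc′≢0 : c * c′ ≢ 0ℤ
  cc′≢0 = *-≢0 c≢0 c′≢0

  constant : (∀ x → D x ≡ 0ℤ) ⊎ ∃[ d ] ∃[ q ] (q ≢ 0ℤ × Lead d q D) →
    ∃[ R ] (R ≢ 0ℤ × Σ[ U ∈ (ℤ → ℤ) ] Σ[ V ∈ (ℤ → ℤ) ] IsPoly U × IsPoly V ×
      (∀ x → f x * U x + g x * V x ≡ R))
  constant (inj₁ D≡0) with k , cp ← ev-sample cop with z , eq ← D∣cc′ (+ k) cp =
    ⊥-elim (cc′≢0 (trans (sym eq) (cong (_* z) (D≡0 (+ k)))))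
  constant (inj₂ (zero , q , q≢0 , lead (none D₀≡0) eq)) =
    q , q≢0 , U , V , U-poly , V-poly , λ x → trans (bezout x)
      (trans (eq x) (trans (cong (λ y → q * 1ℤ + y) (D₀≡0 x)) (lem q)))
    where
    lem : ∀ q → q * 1ℤ + 0ℤ ≡ q
    lem = solve-∀
  constant (inj₂ (suc d , q , q≢0 , l))
    with k , cp , large ← ev-sample (ev-zip (λ _ → _,_) cop (lead-unbounded q≢0 l ∣ c * c′ ∣)) =
    ⊥-elim (ℕ.<⇒≱ large (∣-bound (D (+ k)) (proj₁ (D∣cc′ (+ k) cp)) (proj₂ (D∣cc′ (+ k) cp)) cc′≢0))

-- With f U + g V ≡ R, f and g are periodic modulo R², so a Bézout identity
-- s f + t g = 1 at one point of a residue class modulo R² holds along the whole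
-- class up to a multiple R² y of R², which R y (f U + g V) corrects.
poly-inverses : ∀ {f g} → IsPoly f → IsPoly g → Eventually (λ k → Coprime (f (+ k)) (g (+ k))) →
  Σ[ L ∈ ℕ ] ℕ.NonZero L × (∀ r → Σ[ u ∈ (ℤ → ℤ) ] Σ[ v ∈ (ℤ → ℤ) ] IsPoly u × IsPoly v ×
    (∀ x → f (+ L * x + + r) * u x + g (+ L * x + + r) * v x ≡ 1ℤ))
poly-inverses {f} {g} F G cop@(eventually C p)
  with R , R≢0 , U , V , Up , Vp , eq ← poly-bezout F G cop =
  -- L C + r is a point of the class of r that is at least `C`, so coprimality is known there.
  L , L≢0 , λ r → inverses r (p (L ℕ.* C ℕ.+ r) (k≤L*k+r L r C {{L≢0}}))
  where
  L : ℕ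
  -- A square is nonnegative whatever the sign of `R`, so `+ L` is exactly R².
  L = ∣ R * R ∣

  L≢0 : ℕ.NonZero L
  L≢0 = ≢-nonZero (*-≢0 R≢0 R≢0)

  +L≡R² : + L ≡ R * R
  +L≡R² = trans (cong +_ (abs-* R R)) (square R)
    where
    square : ∀ i → + (∣ i ∣ ℕ.* ∣ i ∣) ≡ i * i
    square (+ n)    = pos-* n n
    square -[1+ n ] = refl

  correct : ∀ R f g s t U V y → f * s + g * t ≡ 1ℤ + R * R * y → f * U + g * V ≡ R →
    f * (s - R * y * U) + g * (t - R * y * V) ≡ 1ℤ
  correct R f g s t U V y eq₁ eq₂ = trans (a₁ R f g s t U V y)
    (trans (cong₂ (λ a b → a - R * y * b) eq₁ eq₂) (a₂ R y))
    where
    a₁ : ∀ R f g s t U V y →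
      f * (s - R * y * U) + g * (t - R * y * V) ≡ (f * s + g * t) - R * y * (f * U + g * V)
    a₁ = solve-∀
    a₂ : ∀ R y → 1ℤ + R * R * y - R * y * R ≡ 1ℤ
    a₂ = solve-∀

  compare : ∀ L f₀ g₀ w w′ z z′ s t → (f₀ + L * w′) * s + (g₀ + L * z′) * t ≡ 1ℤ →
    (f₀ + L * w) * s + (g₀ + L * z) * t ≡ 1ℤ + L * ((w - w′) * s + (z - z′) * t)
  compare L f₀ g₀ w w′ z z′ s t eq = trans (a L f₀ g₀ w w′ z z′ s t)
    (cong (λ y → y + L * ((w - w′) * s + (z - z′) * t)) eq)
    where
    a : ∀ L f₀ g₀ w w′ z z′ s t → (f₀ + L * w) * s + (g₀ + L * z) * t ≡
      ((f₀ + L * w′) * s + (g₀ + L * z′) * t) + L * ((w - w′) * s + (z - z′) * t)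
    a = solve-∀

  inverses : ∀ r → Coprime (f (+ (L ℕ.* C ℕ.+ r))) (g (+ (L ℕ.* C ℕ.+ r))) →
    Σ[ u ∈ (ℤ → ℤ) ] Σ[ v ∈ (ℤ → ℤ) ] IsPoly u × IsPoly v ×
    (∀ x → f (+ L * x + + r) * u x + g (+ L * x + + r) * v x ≡ 1ℤ)
  inverses r (coprime {s} {t} eq₀)
    with w , W , fw ← poly-mod F (+ L) (+ r) | z , Z , gz ← poly-mod G (+ L) (+ r) =
    (λ x → s - R * y x * U (at x)) , (λ x → t - R * y x * V (at x)) ,
    poly-- (poly-const s) (poly-* (poly-scale R Y) (poly-affine Up (+ L) (+ r))) ,
    poly-- (poly-const t) (poly-* (poly-scale R Y) (poly-affine Vp (+ L) (+ r))) ,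
    λ x → correct R (f (at x)) (g (at x)) s t (U (at x)) (V (at x)) (y x) (identity x) (eq (at x))
    where
    at y : ℤ → ℤ
    at x = + L * x + + r
    -- Between the sample point `at (+ C)` and `at x` the values of f and g change by R² (w x - w C)
    -- and R² (z x - z C); hence s f + t g moves from 1 to 1 + R² y.
    y x = (w x - w (+ C)) * s + (z x - z (+ C)) * t

    Y : IsPoly y
    Y = poly-+ (poly-* (poly-- W (poly-const (w (+ C)))) (poly-const s))
               (poly-* (poly-- Z (poly-const (z (+ C)))) (poly-const t))

    identity₀ : f (at (+ C)) * s + g (at (+ C)) * t ≡ 1ℤ
    identity₀ = subst (λ k → f k * s + g k * t ≡ 1ℤ) (pos-affine L r C) eq₀

    identity : ∀ x → f (at x) * s + g (at x) * t ≡ 1ℤ + R * R * y x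
    identity x = trans (cong₂ (λ a b → a * s + b * t) (fw x) (gz x))
      (trans (compare (+ L) (f (+ r)) (g (+ r)) (w x) (w (+ C)) (z x) (z (+ C)) s t
        (trans (sym (cong₂ (λ a b → a * s + b * t) (fw (+ C)) (gz (+ C)))) identity₀))
        (cong (λ a → 1ℤ + a * y x) +L≡R²))

-- Sequences that are polynomial on residue classes

record EvPoly (s : ℕ → ℤ) : Set where
  constructor evPoly
  field
    {extension} : ℤ → ℤ
    isPoly      : IsPoly extension
    agree       : Eventually (λ k → s k ≡ extension (+ k))

-- Unlike in IsQuasiPolynomial, all offsets i are allowed, so that multiples of
-- a period are visibly periods.
record QP (s : ℕ → ℤ) : Set where
  constructor qp
  field
    period       : ℕ
    {{period≢0}} : ℕ.NonZero period
    class        : ∀ i → EvPoly (λ k → s (period ℕ.* k ℕ.+ i))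

evPoly-subst : ∀ {s t} → Eventually (λ k → t k ≡ s k) → EvPoly s → EvPoly t
evPoly-subst eq (evPoly F agree) = evPoly F (ev-zip (λ _ → trans) eq agree)

evPoly-affine : ∀ {s} → EvPoly s → ∀ L r .{{_ : ℕ.NonZero L}} → EvPoly (λ k → s (L ℕ.* k ℕ.+ r))
evPoly-affine (evPoly {f} F agree) L r = evPoly (poly-affine F (+ L) (+ r))
  (ev-map (λ k eq → trans eq (cong f (pos-affine L r k)))
    (ev-subsequence (λ k → L ℕ.* k ℕ.+ r) (λ k → k≤L*k+r L r k) agree))

split-offset : ∀ T .{{_ : ℕ.NonZero T}} k i →
  T ℕ.* k ℕ.+ i ≡ T ℕ.* (k ℕ.+ i ℕ./ T) ℕ.+ i ℕ.% T
split-offset T k i =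
  trans (cong (T ℕ.* k ℕ.+_) (ℕ.m≡m%n+[m/n]*n i T)) (lem T k (i ℕ.% T) (i ℕ./ T))
  where
  lem : ∀ T k r q → T ℕ.* k ℕ.+ (r ℕ.+ q ℕ.* T) ≡ T ℕ.* (k ℕ.+ q) ℕ.+ r
  lem = ℕ.solve-∀

common-period : ∀ (s : ℕ → ℕ → ℤ) → (∀ i → QP (s i)) → ∀ n →
  Σ[ T ∈ ℕ ] ℕ.NonZero T × (∀ i → i ℕ.< n → ∀ j → EvPoly (λ k → s i (T ℕ.* k ℕ.+ j)))
common-period s q zero    = 1 , _ , λ i ()
common-period s q (suc n) with T , T≢0 , c ← common-period s q n | qp T′ {{T′≢0}} c′ ← q n =
  T ℕ.* T′ , ℕ.m*n≢0 T T′ {{T≢0}} {{T′≢0}} , class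
  where
  class : ∀ i → i ℕ.< suc n → ∀ j → EvPoly (λ k → s i (T ℕ.* T′ ℕ.* k ℕ.+ j))
  class i i<1+n j with ℕ.m≤n⇒m<n∨m≡n (ℕ.s≤s⁻¹ i<1+n)
  ... | inj₁ i<n  = evPoly-subst (ev-always λ k → cong (s i) (lem T T′ k j))
                      (evPoly-affine (c i i<n j) T′ 0 {{T′≢0}})
    where
    lem : ∀ T T′ k j → T ℕ.* T′ ℕ.* k ℕ.+ j ≡ T ℕ.* (T′ ℕ.* k ℕ.+ 0) ℕ.+ j
    lem = ℕ.solve-∀
  ... | inj₂ refl = evPoly-subst (ev-always λ k → cong (s i) (lem T T′ k j))
                      (evPoly-affine (c′ j) T 0 {{T≢0}})
    where
    lem : ∀ T T′ k j → T ℕ.* T′ ℕ.* k ℕ.+ j ≡ T′ ℕ.* (T ℕ.* k ℕ.+ 0) ℕ.+ j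
    lem = ℕ.solve-∀

-- The finitely many residues i < T share a period T′, and T T′ k + j lies in the class of j modulo
-- T at position T′ k + j / T. Every restriction to residue classes in the proof is undone here.
qp-merge : ∀ {s} T .{{_ : ℕ.NonZero T}} → (∀ i → QP (λ k → s (T ℕ.* k ℕ.+ i))) → QP s
qp-merge {s} T {{T≢0}} q with T′ , T′≢0 , c ← common-period (λ i k → s (T ℕ.* k ℕ.+ i)) q T =
  record
    { period   = T ℕ.* T′
    ; period≢0 = ℕ.m*n≢0 T T′ {{T≢0}} {{T′≢0}}
    ; class    = λ j → evPoly-subst
        (ev-always λ k → cong s
          (trans (cong (ℕ._+ j) (ℕ.*-assoc T T′ k)) (split-offset T (T′ ℕ.* k) j)))
        (c (j ℕ.% T) (ℕ.m%n<n j T) (j ℕ./ T))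
    }

qp-subst : ∀ {s t} → Eventually (λ k → t k ≡ s k) → QP s → QP t
qp-subst eq (qp T class) = qp T λ i →
  evPoly-subst (ev-subsequence (λ k → T ℕ.* k ℕ.+ i) (λ k → k≤L*k+r T i k) eq) (class i)

evPoly-+ : ∀ {s t} → EvPoly s → EvPoly t → EvPoly (λ k → s k + t k)
evPoly-+ (evPoly F eq) (evPoly G eq′) = evPoly (poly-+ F G) (ev-zip (λ k → cong₂ _+_) eq eq′)

evPoly⇒qp : ∀ {s} → EvPoly s → QP s
evPoly⇒qp E = qp 1 (λ i → evPoly-affine E 1 i)

qp-const : ∀ c → QP (λ _ → c)
qp-const c = evPoly⇒qp (evPoly (poly-const c) (ev-always λ _ → refl))

qp-+ : ∀ {s t} → QP s → QP t → QP (λ k → s k + t k)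
qp-+ {s} {t} (qp T {{T≢0}} c) (qp T′ {{T′≢0}} c′) = record
  { period   = T ℕ.* T′
  ; period≢0 = ℕ.m*n≢0 T T′
  ; class    = λ i → evPoly-+
      (evPoly-subst (ev-always λ k → cong s (lem T T′ k i)) (evPoly-affine (c i) T′ 0))
      (evPoly-subst (ev-always λ k → cong t (lem′ T T′ k i)) (evPoly-affine (c′ i) T 0))
  }
  where
  lem : ∀ T T′ k j → T ℕ.* T′ ℕ.* k ℕ.+ j ≡ T ℕ.* (T′ ℕ.* k ℕ.+ 0) ℕ.+ j
  lem = ℕ.solve-∀
  lem′ : ∀ T T′ k j → T ℕ.* T′ ℕ.* k ℕ.+ j ≡ T′ ℕ.* (T ℕ.* k ℕ.+ 0) ℕ.+ j
  lem′ = ℕ.solve-∀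

-- Floors of quotients

-- Total in the denominator, so that sequences of floors can be written before positivity is known;
-- 0 is a dummy value for denominators that are not positive.
⌊_/_⌋ : ℤ → ℤ → ℤ
⌊ n / +[1+ k ] ⌋ = n /ℕ suc k
⌊ n / _        ⌋ = 0ℤ

-- The remainder condition is common ground for the integer, polynomial and rational floors: with
-- uniqueness, each is identified by checking two inequalities.
record IsFloor (q n b : ℤ) : Set where
  constructor isFloor
  field
    lower : 0ℤ ≤ n - q * b
    upper : n - q * b < b

floor-isFloor : ∀ n {b} → 0ℤ < b → IsFloor ⌊ n / b ⌋ n b
floor-isFloor n {+[1+ k ]} _ = isFloor
  (subst (0ℤ ≤_) (sym remainder) (+≤+ ℕ.z≤n))
  (subst (_< +[1+ k ]) (sym remainder) (+<+ (n%ℕd<d n (suc k))))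
  where
  lem : ∀ r y → r + y - y ≡ r
  lem = solve-∀
  remainder : n - (n /ℕ suc k) * +[1+ k ] ≡ + (n %ℕ suc k)
  remainder = trans (cong (_- (n /ℕ suc k) * +[1+ k ]) (a≡a%ℕn+[a/ℕn]*n n (suc k)))
    (lem (+ (n %ℕ suc k)) (n /ℕ suc k * +[1+ k ]))
floor-isFloor n {+0} (+<+ ())

isFloor-unique : ∀ {q q′ n b} → 0ℤ < b → IsFloor q n b → IsFloor q′ n b → q ≡ q′
isFloor-unique {q} {q′} {n} {b} 0<b F F′ = ≤-antisym (half F F′) (half F′ F)
  where
  half : ∀ {q q′} → IsFloor q n b → IsFloor q′ n b → q ≤ q′
  half {q} {q′} (isFloor lo _) (isFloor _ hi) = suc[i]≤suc[j]⇒i≤j q q′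
    (i<j⇒suc[i]≤j (*-cancelʳ-<-nonNeg {q} {1ℤ + q′} b {{nonNegative (<⇒≤ 0<b)}} (begin-strict
      q * b               ≤⟨ 0≤i-j⇒j≤i lo ⟩
      n                   ≡⟨ lem n (q′ * b) ⟩
      n - q′ * b + q′ * b <⟨ +-monoˡ-< (q′ * b) hi ⟩
      b + q′ * b          ≡⟨ suc-* q′ b ⟨
      (1ℤ + q′) * b       ∎)))
    where
    open ≤-Reasoning
    lem : ∀ n y → n ≡ n - y + y
    lem = solve-∀
    suc[i]≤suc[j]⇒i≤j : ∀ i j → 1ℤ + i ≤ 1ℤ + j → i ≤ j
    suc[i]≤suc[j]⇒i≤j i j le = subst₂ _≤_ (lem₁ i) (lem₁ j) (+-monoʳ-≤ -1ℤ le)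
      where
      lem₁ : ∀ i → -1ℤ + (1ℤ + i) ≡ i
      lem₁ = solve-∀

0<i^n : ∀ {i} n → 0ℤ < i → 0ℤ < i ^ n
0<i^n zero    0<i = +<+ ℕ.z<s
0<i^n (suc n) 0<i = 0<i*j 0<i (0<i^n n 0<i)

0<i*j⇒0<j : ∀ i {j} → 0ℤ < i → 0ℤ < i * j → 0ℤ < j
0<i*j⇒0<j i {j} 0<i 0<i*j =
  *-cancelˡ-<-nonNeg i {{nonNegative (<⇒≤ 0<i)}} (subst (_< i * j) (sym (*-zeroʳ i)) 0<i*j)

-- On the residue class r modulo L = qⁿ the quotient S of the pseudo-division
-- L f = g S + R is c + L S′ with 0 ≤ c < L. Then L (f - g S′) = g c + R lies
-- strictly between - g L and g L, so the floor is S′ or S′ - 1, depending on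
-- the sign of f - g S′.
floor-qp : ∀ {f g} → IsPoly f → IsPoly g → Eventually (λ k → 0ℤ < g (+ k)) →
  QP (λ k → ⌊ f (+ k) / g (+ k) ⌋)
floor-qp {f} {g} F G g>0 with positive⇒lead G g>0
... | d , q , 0<q , l = qp-merge L λ r → evPoly⇒qp (floor-class r)
  where
  open PseudoDivision (pseudoDivide F l) renaming (quotient to S; remainder to R)

  L : ℕ
  L = ∣ q ^ exponent ∣

  0<qⁿ : 0ℤ < q ^ exponent
  0<qⁿ = 0<i^n exponent 0<q

  instance
    L≢0 : ℕ.NonZero L
    L≢0 = >-nonZero 0<qⁿ

  +L≡qⁿ : + L ≡ q ^ exponent
  +L≡qⁿ = 0≤i⇒+∣i∣≡i (<⇒≤ 0<qⁿ)

  0<L : 0ℤ < + L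
  0<L = subst (0ℤ <_) (sym +L≡qⁿ) 0<qⁿ

  -- `R` has smaller degree than `g`, so g + R and g - R keep the leading coefficient q > 0.
  bounds : Eventually (λ k → 0ℤ < g (+ k) × 0ℤ < g (+ k) + 1ℤ * R (+ k) × 0ℤ < g (+ k) + -1ℤ * R (+ k))
  bounds = ev-zip (λ _ → _,_) g>0
    (ev-zip (λ _ → _,_) (lead-positive 0<q (lead-add l remainder-deg 1ℤ))
                        (lead-positive 0<q (lead-add l remainder-deg -1ℤ)))

  floor-class : ∀ r → EvPoly (λ k → ⌊ f (+ (L ℕ.* k ℕ.+ r)) / g (+ (L ℕ.* k ℕ.+ r)) ⌋)
  floor-class r with w , W , S-eq ← poly-mod quotient-poly (+ L) (+ r) =
    by-sign (poly-sign D-poly)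
    where
    c s₀ : ℤ
    c  = + (S (+ r) %ℕ L)
    s₀ = S (+ r) /ℕ L

    at S′ D : ℤ → ℤ
    at x = + L * x + + r
    S′ x = s₀ + w x
    D x  = f (at x) - S′ x * g (at x)

    S′-poly : IsPoly S′
    S′-poly = poly-+ (poly-const s₀) W

    D-poly : IsPoly D
    D-poly = poly-- (poly-affine F (+ L) (+ r)) (poly-* S′-poly (poly-affine G (+ L) (+ r)))

    L*D : ∀ x → + L * D x ≡ g (at x) * c + R (at x)
    L*D x = trans (a₁ (+ L) (f (at x)) (S′ x) (g (at x)))
      (trans (cong (λ y → y * f (at x) - g (at x) * (+ L * S′ x)) +L≡qⁿ)
      (trans (cong (_- g (at x) * (+ L * S′ x)) (division (at x)))
      (trans (cong (λ y → g (at x) * y + R (at x) - g (at x) * (+ L * S′ x))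
               (trans (S-eq x) (cong (_+ + L * w x) (a≡a%ℕn+[a/ℕn]*n (S (+ r)) L))))
             (a₂ (g (at x)) c s₀ (+ L) (w x) (R (at x))))))
      where
      a₁ : ∀ L f s g → L * (f - s * g) ≡ L * f - g * (L * s)
      a₁ = solve-∀
      a₂ : ∀ g c s L w R → g * ((c + s * L) + L * w) + R - g * (L * (s + w)) ≡ g * c + R
      a₂ = solve-∀

    -- Since c ≤ L - 1, one copy of g is left over to absorb `R`: L g - L D = g (L - 1 - c) + (g -
    -- R), and likewise L D + L g = g c + g (L - 1) + (g + R).
    c<L : 0ℤ ≤ + L - (1ℤ + c)
    c<L = i≤j⇒0≤j-i (+≤+ (n%ℕd<d (S (+ r)) L))

    D<g : ∀ x → 0ℤ < g (at x) → 0ℤ < g (at x) + -1ℤ * R (at x) → D x < g (at x)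
    D<g x g>0 g>R = 0<j-i⇒i<j {D x} {g (at x)} (0<i*j⇒0<j (+ L) 0<L
      (subst (0ℤ <_) (trans (a₁ (g (at x)) (+ L) c (R (at x)))
                     (trans (cong (λ y → + L * g (at x) - y) (sym (L*D x)))
                            (a₂ (+ L) (g (at x)) (D x))))
        (+-mono-≤-< (0≤i*j (<⇒≤ g>0) c<L) g>R)))
      where
      a₁ : ∀ g L c R → g * (L - (1ℤ + c)) + (g + -1ℤ * R) ≡ L * g - (g * c + R)
      a₁ = solve-∀
      a₂ : ∀ L g D → L * g - L * D ≡ L * (g - D)
      a₂ = solve-∀

    0<D+g : ∀ x → 0ℤ < g (at x) → 0ℤ < g (at x) + 1ℤ * R (at x) → 0ℤ < D x + g (at x)
    0<D+g x g>0 g>-R = 0<i*j⇒0<j (+ L) 0<L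
      (subst (0ℤ <_) (trans (a₁ (g (at x)) (+ L) c (R (at x)))
                     (trans (cong (_+ + L * g (at x)) (sym (L*D x)))
                            (a₂ (+ L) (g (at x)) (D x))))
        (+-mono-≤-< (+-mono-≤ (0≤i*j (<⇒≤ g>0) (+≤+ (ℕ.z≤n {S (+ r) %ℕ L})))
                              (0≤i*j (<⇒≤ g>0) 1≤L)) g>-R))
      where
      1≤L : 0ℤ ≤ + L - 1ℤ
      1≤L = i≤j⇒0≤j-i (i<j⇒suc[i]≤j 0<L)
      a₁ : ∀ g L c R → g * c + g * (L - 1ℤ) + (g + 1ℤ * R) ≡ (g * c + R) + L * g
      a₁ = solve-∀
      a₂ : ∀ L g D → L * D + L * g ≡ L * (D + g)
      a₂ = solve-∀

    at-bounds : Eventually (λ k → 0ℤ < g (at (+ k)) × 0ℤ < g (at (+ k)) + 1ℤ * R (at (+ k)) ×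
                                  0ℤ < g (at (+ k)) + -1ℤ * R (at (+ k)))
    at-bounds = ev-map (λ k → subst (λ x → 0ℤ < g x × 0ℤ < g x + 1ℤ * R x × 0ℤ < g x + -1ℤ * R x)
                                    (pos-affine L r k))
      (ev-subsequence (λ k → L ℕ.* k ℕ.+ r) (λ k → k≤L*k+r L r k) bounds)

    floor-at : ∀ {h} k → 0ℤ < g (at (+ k)) → IsFloor (h (+ k)) (f (at (+ k))) (g (at (+ k))) →
      ⌊ f (+ (L ℕ.* k ℕ.+ r)) / g (+ (L ℕ.* k ℕ.+ r)) ⌋ ≡ h (+ k)
    floor-at k g>0 fl = trans (cong (λ x → ⌊ f x / g x ⌋) (pos-affine L r k))
      (isFloor-unique g>0 (floor-isFloor (f (at (+ k))) g>0) fl)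

    by-sign : Eventually (λ k → 0ℤ ≤ D (+ k)) ⊎ Eventually (λ k → D (+ k) < 0ℤ) →
      EvPoly (λ k → ⌊ f (+ (L ℕ.* k ℕ.+ r)) / g (+ (L ℕ.* k ℕ.+ r)) ⌋)
    by-sign (inj₁ D≥0) = evPoly S′-poly (ev-zip
      (λ k (g>0 , _ , g>R) D≥0 → floor-at {S′} k g>0 (isFloor D≥0 (D<g (+ k) g>0 g>R)))
      at-bounds D≥0)
    by-sign (inj₂ D<0) = evPoly (poly-- S′-poly (poly-const 1ℤ)) (ev-zip
      (λ k (g>0 , g>-R , _) D<0 → floor-at {λ x → S′ x - 1ℤ} k g>0 (isFloor
        (subst (0ℤ ≤_) (sym (shifted (+ k))) (<⇒≤ (0<D+g (+ k) g>0 g>-R)))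
        (subst₂ _<_ (sym (shifted (+ k))) (+-identityˡ _) (+-monoˡ-< (g (at (+ k))) D<0))))
      at-bounds D<0)
      where
      shifted : ∀ x → f (at x) - (S′ x - 1ℤ) * g (at x) ≡ D x + g (at x)
      shifted x = lem (f (at x)) (S′ x) (g (at x))
        where
        lem : ∀ f s g → f - (s - 1ℤ) * g ≡ f - s * g + g
        lem = solve-∀

-- Translation between the two forms of quasi-polynomials

ev-all : ∀ {P : ℕ → ℕ → Set} n → (∀ i → i ℕ.< n → Eventually (P i)) →
  Eventually (λ k → ∀ i → i ℕ.< n → P i k)
ev-all         zero    p = ev-always λ _ _ ()
ev-all {P} (suc n) p =
  ev-zip extend (ev-all n (λ i i<n → p i (ℕ.m<n⇒m<1+n i<n))) (p n ℕ.≤-refl)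
  where
  extend : ∀ k → (∀ i → i ℕ.< n → P i k) → P n k → ∀ i → i ℕ.< suc n → P i k
  extend k below at-n i i<1+n with ℕ.m≤n⇒m<n∨m≡n (ℕ.s≤s⁻¹ i<1+n)
  ... | inj₁ i<n  = below i i<n
  ... | inj₂ refl = at-n

-- If k < C and i < T, then T k + i < T C; so the bound T C on the index forces k ≥ C in every class
-- at once.
ev-classes : ∀ {P : ℕ → ℕ → Set} T → (∀ i → i ℕ.< T → Eventually (P i)) →
  ∃[ C ] (∀ i k → i ℕ.< T → C ℕ.≤ T ℕ.* k ℕ.+ i → P i k)
ev-classes T p with eventually C holds ← ev-all T p = T ℕ.* C , λ i k i<T large →
  holds k (ℕ.≮⇒≥ λ k<C → ℕ.<⇒≱ (small i k i<T k<C) large) i i<T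
  where
  open ℕ.≤-Reasoning
  small : ∀ i k {C} → i ℕ.< T → k ℕ.< C → T ℕ.* k ℕ.+ i ℕ.< T ℕ.* C
  small i k {C} i<T k<C = begin-strict
    T ℕ.* k ℕ.+ i <⟨ ℕ.+-monoʳ-< (T ℕ.* k) i<T ⟩
    T ℕ.* k ℕ.+ T ≡⟨ ℕ.+-comm (T ℕ.* k) T ⟩
    T ℕ.+ T ℕ.* k ≡⟨ ℕ.*-suc T k ⟨
    T ℕ.* suc k   ≤⟨ ℕ.*-monoʳ-≤ T k<C ⟩
    T ℕ.* C       ∎

isQuasiPolynomial⇒qp : ∀ {f} → IsQuasiPolynomial f → QP f
isQuasiPolynomial⇒qp {f} F = qp T λ i →
  evPoly {extension = λ x → eval (constituent (residue i)) (x + + (i ℕ./ T))}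
    (poly-∘ (poly (constituent (residue i)) λ _ → refl) (poly-+ poly-id (poly-const (+ (i ℕ./ T)))))
    (eventually (suc C) λ k C<k →
      agrees (T ℕ.* k ℕ.+ i) (k ℕ.+ i ℕ./ T) (residue i) (ℕ.≤-trans C<k (k≤L*k+r T i k))
        (trans (split-offset T k i)
               (cong (T ℕ.* (k ℕ.+ i ℕ./ T) ℕ.+_) (sym (Fin.toℕ-fromℕ< (ℕ.m%n<n i T))))))
  where
  open IsQuasiPolynomial F
  residue : ℕ → Fin T
  residue i = fromℕ< (ℕ.m%n<n i T)

qp⇒isQuasiPolynomial : ∀ {f} → QP f → IsQuasiPolynomial f
qp⇒isQuasiPolynomial {f} (qp T class)
  with C , holds ← ev-classes T (λ i _ → EvPoly.agree (class i)) = record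
  -- The successor makes the threshold nonzero, as `IsQuasiPolynomial` demands.
  { T = T ; C = suc C
  ; constituent = λ i → list i
  ; agrees = λ n m i n>C n≡ → trans (cong f n≡)
      (trans (holds (toℕ i) m (Fin.toℕ<n i) (subst (C ℕ.≤_) n≡ (ℕ.<⇒≤ (ℕ.<-trans (ℕ.n<1+n C) n>C))))
             (IsPoly.evals (EvPoly.isPoly (class (toℕ i))) (+ m)))
  }
  where
  list : Fin T → Polynomial
  list i = IsPoly.list (EvPoly.isPoly (class (toℕ i)))

eventually-positive : ∀ {f} (F : IsQuasiPolynomial f) → HasPositiveLeadingCoefficients F →
  Eventually (λ n → 0ℤ < f n)
eventually-positive {f} F pos = eventually (C′ ℕ.⊔ suc C) λ n large →
  subst (0ℤ <_)
    (sym (agrees n (n ℕ./ T) (fromℕ< (ℕ.m%n<n n T)) (ℕ.≤-trans (ℕ.m≤n⊔m C′ (suc C)) large)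
      (trans (split n) (cong (T ℕ.* (n ℕ./ T) ℕ.+_) (sym (Fin.toℕ-fromℕ< (ℕ.m%n<n n T)))))))
    (holds (n ℕ.% T) (n ℕ./ T) (ℕ.m%n<n n T)
      (subst (C′ ℕ.≤_) (split n) (ℕ.≤-trans (ℕ.m≤m⊔n C′ (suc C)) large)) (ℕ.m%n<n n T))
  where
  open IsQuasiPolynomial F

  split : ∀ n → n ≡ T ℕ.* (n ℕ./ T) ℕ.+ n ℕ.% T
  split n = trans (cong (ℕ._+ n) (sym (ℕ.*-zeroʳ T))) (split-offset T 0 n)

  -- `ev-classes` takes predicates indexed by all naturals, so the proof of i < T that `fromℕ<`
  -- takes is quantified inside the predicate.
  class-positive : ∀ i → i ℕ.< T →
    Eventually (λ k → ∀ i<T → 0ℤ < eval (constituent (fromℕ< {i} i<T)) (+ k))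
  class-positive i i<T with leadingCoefficient-lead (constituent (fromℕ< i<T))
  ... | inj₁ (l≡0 , _)   = ⊥-elim (<-irrefl (sym l≡0) (pos (fromℕ< i<T)))
  ... | inj₂ (_ , d , l) =
    ev-map (λ k 0<f i<T′ → 0<f)
      (lead-positive (pos (fromℕ< i<T)) l)

  classes : ∃[ C′ ] (∀ i k → i ℕ.< T → C′ ℕ.≤ T ℕ.* k ℕ.+ i →
    ∀ i<T → 0ℤ < eval (constituent (fromℕ< {i} i<T)) (+ k))
  classes = ev-classes T class-positive

  C′ : ℕ
  C′ = proj₁ classes

  holds : ∀ i k → i ℕ.< T → C′ ℕ.≤ T ℕ.* k ℕ.+ i →
    ∀ i<T → 0ℤ < eval (constituent (fromℕ< {i} i<T)) (+ k)
  holds = proj₂ classes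

-- Pointwise coprimality

bezout-coprime : ∀ {a b} → 0ℤ < a → 0ℤ < b → ℕ.gcd ∣ a ∣ ∣ b ∣ ≡ 1 → Coprime a b
bezout-coprime {+ A} {+ B} _ _ gcd≡1
  with ℕ.Bézout.identity (subst (ℕ.GCD A B) gcd≡1 (ℕ.gcd-GCD A B))
... | ℕ.Bézout.+- x y eq = coprime {u = + x} {v = - + y}
  (trans (regroup (+ A) (+ B) (+ x) (+ y)) (trans (cong (_- + y * + B) (sym eqℤ)) (cancel (+ y * + B))))
  where
  regroup : ∀ a b x y → a * x + b * - y ≡ x * a - y * b
  regroup = solve-∀
  cancel : ∀ z → 1ℤ + z - z ≡ 1ℤ
  cancel = solve-∀
  eqℤ : 1ℤ + + y * + B ≡ + x * + A
  eqℤ = trans (cong (λ z → 1ℤ + z) (sym (pos-* y B))) (trans (cong +_ eq) (pos-* x A))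
... | ℕ.Bézout.-+ x y eq = coprime {u = - + x} {v = + y}
  (trans (regroup (+ A) (+ B) (+ x) (+ y)) (trans (cong (_- + x * + A) (sym eqℤ)) (cancel (+ x * + A))))
  where
  regroup : ∀ a b x y → a * - x + b * y ≡ y * b - x * a
  regroup = solve-∀
  cancel : ∀ z → 1ℤ + z - z ≡ 1ℤ
  cancel = solve-∀
  eqℤ : 1ℤ + + x * + A ≡ + y * + B
  eqℤ = trans (cong (λ z → 1ℤ + z) (sym (pos-* x A))) (trans (cong +_ eq) (pos-* y B))

-- A quasi-polynomial may be changed at a single point, so the greatest common
-- divisor being 1 forces coprimality at every n.
ggcd-coprime : ∀ {a b} → IsGGCD (a ∷ b ∷ []) (λ _ → 1ℤ) →
  ∀ n → 0ℤ < a n → 0ℤ < b n → Coprime (a n) (b n)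
ggcd-coprime {a} {b} G n a>0 b>0 = bezout-coprime a>0 b>0
  (trans (sym (cong ∣_∣ spike-at-n)) (ℕ.∣1⇒≡1 (proj₂ (greatest spike (qp⇒isQuasiPolynomial spike-qp)
    ((spike≢0 , spike∣a) ∷ (spike≢0 , spike∣b) ∷ [])) n)))
  where
  open IsGGCD G
  g : ℕ
  g = ℕ.gcd ∣ a n ∣ ∣ b n ∣

  spike : ℕ → ℤ
  spike k with k ℕ.≟ n
  ... | yes _ = + g
  ... | no _  = 1ℤ

  spike-at-n : spike n ≡ + g
  spike-at-n with n ℕ.≟ n
  ... | yes _  = refl
  ... | no n≢n = ⊥-elim (n≢n refl)

  spike-qp : QP spike
  spike-qp = qp-subst (eventually (suc n) off) (qp-const 1ℤ)
    where
    off : ∀ k → n ℕ.< k → spike k ≡ 1ℤ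
    off k n<k with k ℕ.≟ n
    ... | yes refl = ⊥-elim (ℕ.<-irrefl refl n<k)
    ... | no _     = refl

  spike≢0 : ∀ k → spike k ≢ 0ℤ
  spike≢0 k with k ℕ.≟ n
  ... | no _  = λ ()
  ... | yes _ = λ g≡0 → <-irrefl
    (sym (∣i∣≡0⇒i≡0 (ℕ.gcd[m,n]≡0⇒m≡0 (cong ∣_∣ g≡0)))) a>0

  spike∣a : ∀ k → ∣ spike k ∣ ℕ.∣ ∣ a k ∣
  spike∣a k with k ℕ.≟ n
  ... | yes refl = ℕ.gcd[m,n]∣m ∣ a n ∣ ∣ b n ∣
  ... | no _     = ℕ.1∣ _

  spike∣b : ∀ k → ∣ spike k ∣ ℕ.∣ ∣ b k ∣
  spike∣b k with k ℕ.≟ n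
  ... | yes refl = ℕ.gcd[m,n]∣n ∣ a n ∣ ∣ b n ∣
  ... | no _     = ℕ.1∣ _

-- Counting solutions

-- For an integer K, the number of pairs (s, t) of naturals with s + t = K.
cardinality : ℤ → ℕ
cardinality (+ k)    = suc k
cardinality -[1+ _ ] = 0

0<1+i⇒0≤i : ∀ i → 0ℤ < 1ℤ + i → 0ℤ ≤ i
0<1+i⇒0≤i (+ _)         _         = +≤+ ℕ.z≤n
0<1+i⇒0≤i -[1+ zero ]   (+<+ ())
0<1+i⇒0≤i -[1+ suc _ ]  ()

-- The hypothesis says i ≥ -1. At i = -1 both sides are 0; below that the right side is negative.
cardinality≡1+ : ∀ i → 0ℤ < 1ℤ + (1ℤ + i) → + cardinality i ≡ 1ℤ + i
cardinality≡1+ (+ _)               _        = refl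
cardinality≡1+ -[1+ zero ]         _        = refl
cardinality≡1+ -[1+ suc zero ]     (+<+ ())
cardinality≡1+ -[1+ suc (suc _) ]  ()

solution-≡ : ∀ {a b m} {s t : Solutions a b m} →
  proj₁ (proj₁ s) ≡ proj₁ (proj₁ t) → proj₂ (proj₁ s) ≡ proj₂ (proj₁ t) → s ≡ t
solution-≡ {s = (x , y) , p , q , e} {t = (_ , _) , p′ , q′ , e′} refl refl
  with refl ← ≤-irrelevant p p′ | refl ← ≤-irrelevant q q′
     | refl ← Decidable⇒UIP.≡-irrelevant _≟_ e e′ = refl

↔-Fin : ∀ {A : Set} {n} (val : A → ℕ) → (∀ x → val x ℕ.< n) → (∀ x y → val x ≡ val y → x ≡ y) →
  (mk : ∀ i → i ℕ.< n → A) → (∀ i i<n → val (mk i i<n) ≡ i) → A ↔ Fin n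
↔-Fin val val<n val-injective mk val-mk = mk↔ₛ′
  (λ x → fromℕ< (val<n x))
  (λ i → mk (toℕ i) (Fin.toℕ<n i))
  (λ i → Fin.toℕ-injective (trans (Fin.toℕ-fromℕ< _) (val-mk (toℕ i) (Fin.toℕ<n i))))
  (λ x → val-injective _ x (trans (val-mk _ _) (Fin.toℕ-fromℕ< (val<n x))))

-- With m = a r₁ + b r₂ + a b K, where r₁ and r₂ are reduced, the solutions of
-- x₁ a + x₂ b = m are x₁ = r₁ + b s, x₂ = r₂ + a t with s + t = K.
module CountSolutions {a b m r₁ r₂ K u v : ℤ} (a>0 : 0ℤ < a) (b>0 : 0ℤ < b)
  (0≤r₁ : 0ℤ ≤ r₁) (r₁<b : r₁ < b) (0≤r₂ : 0ℤ ≤ r₂) (r₂<a : r₂ < a)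
  (bezout : a * u + b * v ≡ 1ℤ) (decomposition : m ≡ r₁ * a + r₂ * b + a * b * K) where

  -- c (1 + s) = x + (c - r) > 0: reducedness of r is what excludes s = -1.
  quotient-nonNegative : ∀ {c x r s} → 0ℤ < c → 0ℤ ≤ x → r < c → x ≡ r + c * s → 0ℤ ≤ s
  quotient-nonNegative {c} {x} {r} {s} 0<c 0≤x r<c eq =
    0<1+i⇒0≤i s (0<i*j⇒0<j c 0<c
      (subst (0ℤ <_) (trans (cong (λ z → z + (c - r)) eq) (lem r c s))
        (+-mono-≤-< 0≤x (i<j⇒0<j-i r<c))))
    where
    lem : ∀ r c s → r + c * s + (c - r) ≡ c * (1ℤ + s)
    lem = solve-∀

  -- Write x₁ - r₁ = (a u + b v) (x₁ - r₁); the equation gives a (x₁ - r₁) = b (r₂ + a K - x₂), so b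
  -- divides both parts. Swapping the roles of a and b yields the second coordinate.
  coordinate : ∀ a b u v x₁ x₂ r₁ r₂ K → a * u + b * v ≡ 1ℤ →
    x₁ * a + x₂ * b ≡ r₁ * a + r₂ * b + a * b * K →
    x₁ ≡ r₁ + b * (u * (r₂ + a * K - x₂) + v * (x₁ - r₁))
  coordinate a b u v x₁ x₂ r₁ r₂ K bez eq =
    trans (a₁ x₁ r₁)
    (trans (cong (λ z → r₁ + z * (x₁ - r₁)) (sym bez))
    (trans (a₂ a b u v x₁ x₂ r₁)
    (trans (cong (λ z → r₁ + u * (z - r₁ * a - x₂ * b) + b * v * (x₁ - r₁)) eq)
           (a₃ a b u v x₁ x₂ r₁ r₂ K))))
    where
    a₁ : ∀ x r → x ≡ r + 1ℤ * (x - r)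
    a₁ = solve-∀
    a₂ : ∀ a b u v x₁ x₂ r₁ → r₁ + (a * u + b * v) * (x₁ - r₁) ≡
      r₁ + u * (x₁ * a + x₂ * b - r₁ * a - x₂ * b) + b * v * (x₁ - r₁)
    a₂ = solve-∀
    a₃ : ∀ a b u v x₁ x₂ r₁ r₂ K →
      r₁ + u * (r₁ * a + r₂ * b + a * b * K - r₁ * a - x₂ * b) + b * v * (x₁ - r₁) ≡
      r₁ + b * (u * (r₂ + a * K - x₂) + v * (x₁ - r₁))
    a₃ = solve-∀

  abstract
    parametrize : (σ : Solutions a b m) → let x₁ , x₂ = proj₁ σ in
      ∃[ s ] ∃[ t ] (x₁ ≡ r₁ + b * + s × x₂ ≡ r₂ + a * + t × + s + + t ≡ K)
    parametrize ((x₁ , x₂) , 0≤x₁ , 0≤x₂ , eq) =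
      ∣ s ∣ , ∣ t ∣ ,
      trans x₁-eq (cong (λ z → r₁ + b * z) (sym +s)) ,
      trans x₂-eq (cong (λ z → r₂ + a * z) (sym +t)) ,
      -- In s + t all terms with x₁, x₂, r₁, r₂ cancel, leaving (a u + b v) K.
      trans (cong₂ _+_ +s +t) (trans (a₂ a b u v x₁ x₂ r₁ r₂ K)
        (trans (cong (_* K) bezout) (*-identityˡ K)))
      where
      s t : ℤ
      s = u * (r₂ + a * K - x₂) + v * (x₁ - r₁)
      t = v * (r₁ + b * K - x₁) + u * (x₂ - r₂)
      a₁ : ∀ a b r₁ r₂ K → r₁ * a + r₂ * b + a * b * K ≡ r₂ * b + r₁ * a + b * a * K
      a₁ = solve-∀
      a₂ : ∀ a b u v x₁ x₂ r₁ r₂ K →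
        (u * (r₂ + a * K - x₂) + v * (x₁ - r₁)) + (v * (r₁ + b * K - x₁) + u * (x₂ - r₂)) ≡
        (a * u + b * v) * K
      a₂ = solve-∀
      x₁-eq : x₁ ≡ r₁ + b * s
      x₁-eq = coordinate a b u v x₁ x₂ r₁ r₂ K bezout (trans eq decomposition)
      x₂-eq : x₂ ≡ r₂ + a * t
      x₂-eq = coordinate b a v u x₂ x₁ r₂ r₁ K (trans (+-comm (b * v) (a * u)) bezout)
        (trans (+-comm (x₂ * b) (x₁ * a)) (trans eq (trans decomposition (a₁ a b r₁ r₂ K))))
      +s : + ∣ s ∣ ≡ s
      +s = 0≤i⇒+∣i∣≡i (quotient-nonNegative b>0 0≤x₁ r₁<b x₁-eq)
      +t : + ∣ t ∣ ≡ t
      +t = 0≤i⇒+∣i∣≡i (quotient-nonNegative a>0 0≤x₂ r₂<a x₂-eq)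

  solution : ∀ s t → + s + + t ≡ K → Solutions a b m
  solution s t s+t≡K = (r₁ + b * + s , r₂ + a * + t) ,
    +-mono-≤ 0≤r₁ (0≤i*j (<⇒≤ b>0) (+≤+ (ℕ.z≤n {s}))) ,
    +-mono-≤ 0≤r₂ (0≤i*j (<⇒≤ a>0) (+≤+ (ℕ.z≤n {t}))) ,
    trans (lem a b r₁ r₂ (+ s) (+ t))
      (trans (cong (λ z → r₁ * a + r₂ * b + a * b * z) s+t≡K) (sym decomposition))
    where
    lem : ∀ a b r₁ r₂ s t →
      (r₁ + b * s) * a + (r₂ + a * t) * b ≡ r₁ * a + r₂ * b + a * b * (s + t)
    lem = solve-∀

  +-cancel-scaled : ∀ r {c} s t → 0ℤ < c → r + c * + s ≡ r + c * + t → s ≡ t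
  +-cancel-scaled r {c} s t 0<c eq = +-injective
    (*-cancelˡ-≡ c (+ s) (+ t) {{>-nonZero 0<c}} (∙-cancelˡ +-0-abelianGroup r (c * + s) (c * + t) eq))

  slack : Solutions a b m → ℕ
  slack σ = proj₁ (proj₂ (parametrize σ))

  slack-spec : ∀ σ → proj₂ (proj₁ σ) ≡ r₂ + a * + slack σ
  slack-spec σ = proj₁ (proj₂ (proj₂ (proj₂ (parametrize σ))))

  slack-injective : ∀ σ τ → slack σ ≡ slack τ → σ ≡ τ
  slack-injective σ τ eq = solution-≡ {a} {b} {m} {σ} {τ} x₁-eq x₂-eq
    where
    x₂-eq : proj₂ (proj₁ σ) ≡ proj₂ (proj₁ τ)
    x₂-eq = trans (slack-spec σ) (trans (cong (λ t → r₂ + a * + t) eq) (sym (slack-spec τ)))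
    x₁-eq : proj₁ (proj₁ σ) ≡ proj₁ (proj₁ τ)
    x₁-eq = *-cancelʳ-≡ (proj₁ (proj₁ σ)) (proj₁ (proj₁ τ)) a {{>-nonZero a>0}}
      (∙-cancelʳ +-0-abelianGroup (proj₂ (proj₁ τ) * b) (proj₁ (proj₁ σ) * a) (proj₁ (proj₁ τ) * a)
        (trans (cong (λ x → proj₁ (proj₁ σ) * a + x * b) (sym x₂-eq))
               (trans (proj₂ (proj₂ (proj₂ σ))) (sym (proj₂ (proj₂ (proj₂ τ)))))))

  slack-bound : ∀ σ → ∃[ s ] + s + + slack σ ≡ K
  slack-bound σ = proj₁ (parametrize σ) , proj₂ (proj₂ (proj₂ (proj₂ (parametrize σ))))

  -- The parameter found by `parametrize` is not computed: it and t give the same second coordinate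
  -- r₂ + a t, and a > 0 cancels.
  slack-solution : ∀ s t eq → slack (solution s t eq) ≡ t
  slack-solution s t eq = +-cancel-scaled r₂ (slack (solution s t eq)) t a>0
    (sym (slack-spec (solution s t eq)))

  hasCardinality : Solutions a b m HasCardinality cardinality K
  hasCardinality = by-sign K refl
    where
    by-sign : ∀ K′ → K ≡ K′ → Solutions a b m ↔ Fin (cardinality K′)
    by-sign -[1+ n ] K≡ = ↔-Fin slack (λ σ → ⊥-elim (absurd σ)) slack-injective (λ _ ()) (λ _ ())
      where
      absurd : Solutions a b m → ⊥
      absurd σ with () ← trans (proj₂ (slack-bound σ)) K≡
    by-sign (+ k) K≡ = ↔-Fin slack bounded slack-injective
      (λ t t≤k → solution (k ℕ.∸ t) t (total t t≤k))
      (λ t t≤k → slack-solution (k ℕ.∸ t) t (total t t≤k))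
      where
      bounded : ∀ σ → slack σ ℕ.< suc k
      bounded σ = ℕ.s≤s (subst (slack σ ℕ.≤_)
        (+-injective (trans (proj₂ (slack-bound σ)) K≡)) (ℕ.m≤n+m (slack σ) (proj₁ (slack-bound σ))))

      total : ∀ t → t ℕ.< suc k → + (k ℕ.∸ t) + + t ≡ K
      total t t≤k = trans (cong +_ (ℕ.m∸n+n≡m (ℕ.s≤s⁻¹ t≤k))) (sym K≡)

-- The term w m accounts for u and v being inverses that come from two
-- different Bézout identities.
floorSum : (a b u v w m : ℤ) → ℤ
floorSum a b u v w m = ⌊ u * m / b ⌋ + ⌊ v * m / a ⌋ + w * m

module FloorSum {a b u v w : ℤ} (a>0 : 0ℤ < a) (b>0 : 0ℤ < b)
  (bezout : a * u + b * v + a * b * w ≡ 1ℤ) (m : ℤ) where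

  private
    F₁ F₂ r₁ r₂ K : ℤ
    F₁ = ⌊ u * m / b ⌋
    F₂ = ⌊ v * m / a ⌋
    r₁ = u * m - F₁ * b
    r₂ = v * m - F₂ * a
    K = floorSum a b u v w m
    open IsFloor (floor-isFloor (u * m) b>0) renaming (lower to 0≤r₁; upper to r₁<b)
    open IsFloor (floor-isFloor (v * m) a>0) renaming (lower to 0≤r₂; upper to r₂<a)

    decomposition : m ≡ r₁ * a + r₂ * b + a * b * K
    decomposition = trans (sym (*-identityˡ m)) (trans (cong (_* m) (sym bezout))
      (lem a b u v w m F₁ F₂))
      where
      lem : ∀ a b u v w m F₁ F₂ → (a * u + b * v + a * b * w) * m ≡
        (u * m - F₁ * b) * a + (v * m - F₂ * a) * b + a * b * (F₁ + F₂ + w * m)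
      lem = solve-∀

  solutions : Solutions a b m HasCardinality cardinality K
  -- Absorbing the defect into u gives the genuine Bézout pair u + b w, v; the remainders still come
  -- from the original u and v.
  solutions = CountSolutions.hasCardinality {a} {b} {m} {r₁} {r₂} {K} {u + b * w} {v}
    a>0 b>0 0≤r₁ r₁<b 0≤r₂ r₂<a (trans (lem a b u v w) bezout) decomposition
    where
    lem : ∀ a b u v w → a * (u + b * w) + b * v ≡ a * u + b * v + a * b * w
    lem = solve-∀

  -- Adding the positive number a (b - r₁) + b (a - r₂) to m gives a b (2 + K), so K ≥ -1. The value
  -- -1 is attained when a nonnegative m has no representation.
  cardinality≡ : 0ℤ ≤ m → + cardinality K ≡ 1ℤ + K
  cardinality≡ 0≤m = cardinality≡1+ K (0<i*j⇒0<j (a * b) (0<i*j a>0 b>0)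
    (subst (0ℤ <_) (trans (cong (λ z → z + (a * (b - r₁) + b * (a - r₂))) decomposition)
                          (lem a b r₁ r₂ K))
      (+-mono-≤-< 0≤m (+-mono-< (0<i*j a>0 (i<j⇒0<j-i r₁<b)) (0<i*j b>0 (i<j⇒0<j-i r₂<a))))))
    where
    lem : ∀ a b r₁ r₂ K → r₁ * a + r₂ * b + a * b * K + (a * (b - r₁) + b * (a - r₂)) ≡
      a * b * (1ℤ + (1ℤ + K))
    lem = solve-∀

-- The rational formula

isFloor-scale : ∀ {q n b} g → 0ℤ < g → IsFloor q n b → IsFloor q (n * g) (b * g)
isFloor-scale {q} {n} {b} g 0<g (isFloor lo hi) = isFloor
  (subst (0ℤ ≤_) (lem n q b g) (0≤i*j lo (<⇒≤ 0<g)))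
  (subst (_< b * g) (lem n q b g) (*-monoʳ-<-pos g {{positive 0<g}} hi))
  where
  lem : ∀ n q b g → (n - q * b) * g ≡ n * g - q * (b * g)
  lem = solve-∀

floor-ℚ-isFloor : ∀ p → IsFloor (ℚ.floor p) (↥ p) (↧ p)
floor-ℚ-isFloor (mkℚ n d-1 _) = subst (λ q → IsFloor q n +[1+ d-1 ])
  (sym (div-pos-is-/ℕ n (suc d-1))) (floor-isFloor n (+<+ ℕ.z<s))

-- The rational is stored in lowest terms; multiplying numerator and denominator by the gcd restores
-- i and k + 1 without changing the floor.
floor-/ : ∀ i k → ℚ.floor (i / suc k) ≡ ⌊ i / +[1+ k ] ⌋
floor-/ i k = isFloor-unique {n = i} (+<+ ℕ.z<s)
  (subst₂ (IsFloor (ℚ.floor (i / suc k))) (ℚ.↥-/ i (suc k)) (ℚ.↧-/ i (suc k))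
    (isFloor-scale {b = ↧ (i / suc k)} (gcd i +[1+ k ]) 0<gcd (floor-ℚ-isFloor (i / suc k))))
  (floor-isFloor i (+<+ ℕ.z<s))
  where
  0<gcd : 0ℤ < gcd i +[1+ k ]
  0<gcd = 0<i*j⇒0<j (↧ (i / suc k)) (+<+ ℕ.z<s)
    (subst (0ℤ <_) (sym (ℚ.↧-/ i (suc k))) (+<+ ℕ.z<s))

/-+ : ∀ i k j l → i / suc k ℚ.+ j / suc l ≡ (i * +[1+ l ] + j * +[1+ k ]) / (suc k ℕ.* suc l)
/-+ i k j l = ℚ.toℚᵘ-injective (ℚᵘ.≃-trans (ℚ.toℚᵘ-homo-+ (i / suc k) (j / suc l))
  (ℚᵘ.≃-trans (ℚᵘ.+-cong (ℚ.toℚᵘ-fromℚᵘ (mkℚᵘ i k)) (ℚ.toℚᵘ-fromℚᵘ (mkℚᵘ j l)))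
    (ℚᵘ.≃-sym (ℚ.toℚᵘ-fromℚᵘ (mkℚᵘ i k ℚᵘ.+ mkℚᵘ j l)))))

/-cross : ∀ i k j l → i * +[1+ l ] ≡ j * +[1+ k ] → i / suc k ≡ j / suc l
/-cross i k j l eq = ℚ.fromℚᵘ-cong {mkℚᵘ i k} {mkℚᵘ j l} (*≡* eq)

/1-+ : ∀ i j → i / 1 ℚ.+ j / 1 ≡ (i + j) / 1
/1-+ i j = trans (/-+ i 0 j 0) (cong (_/ 1) (cong₂ _+_ (*-identityʳ i) (*-identityʳ j)))

m/ab-splits : ∀ k l u v w m →
  +[1+ k ] * u + +[1+ l ] * v + +[1+ k ] * +[1+ l ] * w ≡ 1ℤ →
  m / (suc k ℕ.* suc l) ≡ (u * m) / suc l ℚ.+ (v * m) / suc k ℚ.+ (w * m) / 1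
m/ab-splits k l u v w m bezout = sym (trans (cong (ℚ._+ (w * m) / 1) (/-+ (u * m) l (v * m) k))
  (trans (/-+ (u * m * +[1+ k ] + v * m * +[1+ l ]) _ (w * m) 0)
    (/-cross (((u * m) * +[1+ k ] + (v * m) * +[1+ l ]) * +[1+ 0 ] + (w * m) * (+[1+ l ] * +[1+ k ]))
              (ℕ.pred (suc l ℕ.* suc k ℕ.* 1)) m (ℕ.pred (suc k ℕ.* suc l)) cross)))
  where
  lem′ : ∀ a b m → 1ℤ * m * (a * b) ≡ m * (b * a * 1ℤ)
  lem′ = solve-∀
  lem : ∀ a b u v w m → (u * m * a + v * m * b) * 1ℤ + w * m * (b * a) ≡ (a * u + b * v + a * b * w) * m
  lem = solve-∀
  cross : (((u * m) * +[1+ k ] + (v * m) * +[1+ l ]) * 1ℤ + (w * m) * (+[1+ l ] * +[1+ k ])) *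
            (+[1+ k ] * +[1+ l ]) ≡ m * (+[1+ l ] * +[1+ k ] * 1ℤ)
  cross = trans (cong (_* (+[1+ k ] * +[1+ l ])) (trans (lem +[1+ k ] +[1+ l ] u v w m) (cong (_* m) bezout)))
                (lem′ +[1+ k ] +[1+ l ] m)

-- Since m / (a b) = u m / b + v m / a + w m, subtracting the two fractional parts leaves the floors
-- and the integer w m.
formula-value : ∀ {a b u v w m} (a>0 : 0ℤ < a) (b>0 : 0ℤ < b) →
  a * u + b * v + a * b * w ≡ 1ℤ →
  countFormula a b u v m {{>-nonZero a>0}} {{>-nonZero b>0}} ≡ (1ℤ + floorSum a b u v w m) / 1
formula-value {+[1+ k ]} {+[1+ l ]} {u} {v} {w} {m} _ _ bezout =
  trans (cong (λ x → x ℚ.- frac ((u * m) / suc l) ℚ.- frac ((v * m) / suc k) ℚ.+ 1ℚ)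
          (m/ab-splits k l u v w m bezout))
  (trans (cancel ((u * m) / suc l) ((v * m) / suc k) ((w * m) / 1)
           (ℚ.floor ((u * m) / suc l) / 1) (ℚ.floor ((v * m) / suc k) / 1) 1ℚ)
  (trans (cong₂ (λ F G → 1ℚ ℚ.+ (F / 1 ℚ.+ G / 1 ℚ.+ (w * m) / 1))
           (floor-/ (u * m) l) (floor-/ (v * m) k))
  (trans (cong (λ x → 1ℚ ℚ.+ (x ℚ.+ (w * m) / 1)) (/1-+ ⌊ u * m / +[1+ l ] ⌋ ⌊ v * m / +[1+ k ] ⌋))
  (trans (cong (1ℚ ℚ.+_) (/1-+ (⌊ u * m / +[1+ l ] ⌋ + ⌊ v * m / +[1+ k ] ⌋) (w * m)))
         (/1-+ 1ℤ (floorSum +[1+ k ] +[1+ l ] u v w m))))))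
  where
  cancel : ∀ x y z F G o → x ℚ.+ y ℚ.+ z ℚ.- (x ℚ.- F) ℚ.- (y ℚ.- G) ℚ.+ o ≡ o ℚ.+ (F ℚ.+ G ℚ.+ z)
  cancel = solve 6 (λ x y z F G o →
    x :+ y :+ z :- (x :- F) :- (y :- G) :+ o := o :+ (F :+ G :+ z)) refl
    where open +-*-Solver
formula-value {+0} (+<+ ())
formula-value {+[1+ _ ]} {+0} _ (+<+ ())

-- The counting function and the theorem

-- Defined from pointwise Bézout coefficients, hence before any inverse is given. The 0 in the last
-- clause is a default where no finite count is claimed.
count : (a b m : ℤ) → (0ℤ < a → 0ℤ < b → Coprime a b) → ℕ
count a b m cop with 0ℤ <? a | 0ℤ <? b
... | yes a>0 | yes b>0 = let open Coprime (cop a>0 b>0) in cardinality (floorSum a b u v 0ℤ m)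
... | _       | _       = 0

count-solutions : ∀ a b m cop → 0ℤ < a → 0ℤ < b → Solutions a b m HasCardinality count a b m cop
count-solutions a b m cop a>0 b>0 with 0ℤ <? a | 0ℤ <? b
... | yes a>0′ | yes b>0′ = FloorSum.solutions a>0 b>0 (trans (lem a b u v) bezout) m
  where
  open Coprime (cop a>0′ b>0′)
  lem : ∀ a b u v → a * u + b * v + a * b * 0ℤ ≡ a * u + b * v
  lem = solve-∀
... | no a≯0 | _      = ⊥-elim (a≯0 a>0)
... | yes _  | no b≯0 = ⊥-elim (b≯0 b>0)

-- Both sides count the same set, so the choice of coefficients is immaterial. This admits
-- polynomial inverses for quasi-polynomiality and the prescribed inverses for the formula.
count≡ : ∀ a b u v w m cop → 0ℤ < a → 0ℤ < b → 0ℤ ≤ m → a * u + b * v + a * b * w ≡ 1ℤ →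
  + count a b m cop ≡ 1ℤ + floorSum a b u v w m
count≡ a b u v w m cop a>0 b>0 0≤m bezout = trans
  (cong +_ (↔⇒≡ (solutions m ↔-∘ ↔-sym (count-solutions a b m cop a>0 b>0))))
  (cardinality≡ m 0≤m)
  where open FloorSum a>0 b>0 bezout

count-qp : ∀ {a b m : ℕ → ℤ} (cop : ∀ k → 0ℤ < a k → 0ℤ < b k → Coprime (a k) (b k)) →
  EvPoly a → EvPoly b → EvPoly m →
  Eventually (λ k → 0ℤ < a k × 0ℤ < b k × 0ℤ < m k) →
  QP (λ k → + count (a k) (b k) (m k) (cop k))
count-qp {a} {b} {m} cop (evPoly {f} F a≡f) (evPoly {g} G b≡g) (evPoly {h} H m≡h) all-positive =
  let L , L≢0 , inverses = poly-inverses F G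
        (ev-zip (λ k (a>0 , b>0 , _) (a≡ , b≡ , _) → subst₂ Coprime a≡ b≡ (cop k a>0 b>0))
          all-positive agreement)
  in qp-merge L {{L≢0}} λ r →
     let u , v , U , V , bezout = inverses r in class L {{L≢0}} r u v U V bezout
  where
  agreement : Eventually (λ k → a k ≡ f (+ k) × b k ≡ g (+ k) × m k ≡ h (+ k))
  agreement = ev-zip (λ _ → _,_) a≡f (ev-zip (λ _ → _,_) b≡g m≡h)

  class : ∀ L .{{_ : ℕ.NonZero L}} r (u v : ℤ → ℤ) → IsPoly u → IsPoly v →
    (∀ x → f (+ L * x + + r) * u x + g (+ L * x + + r) * v x ≡ 1ℤ) →
    QP (λ k → let n = L ℕ.* k ℕ.+ r in + count (a n) (b n) (m n) (cop n))
  class L r u v U V bezout = qp-subst (ev-zip value class-positive class-agreement)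
    (qp-+ (qp-const 1ℤ) (qp-+ (qp-+
      (floor-qp (poly-* U (poly-affine H (+ L) (+ r))) (poly-affine G (+ L) (+ r))
        (ev-zip (λ k (_ , b>0 , _) (_ , b≡ , _) → subst (0ℤ <_) b≡ b>0) class-positive class-agreement))
      (floor-qp (poly-* V (poly-affine H (+ L) (+ r))) (poly-affine F (+ L) (+ r))
        (ev-zip (λ k (a>0 , _) (a≡ , _) → subst (0ℤ <_) a≡ a>0) class-positive class-agreement)))
      -- The summand w m of `floorSum`, with w = 0 because u and v satisfy one common identity here.
      (qp-const 0ℤ)))
    where
    at : ℤ → ℤ
    at x = + L * x + + r

    index : ℕ → ℕ
    index k = L ℕ.* k ℕ.+ r

    class-positive : Eventually (λ k → 0ℤ < a (index k) × 0ℤ < b (index k) × 0ℤ < m (index k))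
    class-positive = ev-subsequence index (λ k → k≤L*k+r L r k) all-positive

    class-agreement : Eventually (λ k →
      a (index k) ≡ f (at (+ k)) × b (index k) ≡ g (at (+ k)) × m (index k) ≡ h (at (+ k)))
    class-agreement = ev-map
      (λ k → subst (λ x → a (index k) ≡ f x × b (index k) ≡ g x × m (index k) ≡ h x) (pos-affine L r k))
      (ev-subsequence index (λ k → k≤L*k+r L r k) agreement)

    value : ∀ k → 0ℤ < a (index k) × 0ℤ < b (index k) × 0ℤ < m (index k) →
      a (index k) ≡ f (at (+ k)) × b (index k) ≡ g (at (+ k)) × m (index k) ≡ h (at (+ k)) →
      + count (a (index k)) (b (index k)) (m (index k)) (cop (index k)) ≡
      1ℤ + floorSum (f (at (+ k))) (g (at (+ k))) (u (+ k)) (v (+ k)) 0ℤ (h (at (+ k)))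
    value k (a>0 , b>0 , m>0) (a≡ , b≡ , m≡) = trans
      (count≡ (a (index k)) (b (index k)) (u (+ k)) (v (+ k)) 0ℤ (m (index k)) (cop (index k))
        a>0 b>0 (<⇒≤ m>0)
        (trans (trans (lem (a (index k)) (b (index k)) (u (+ k)) (v (+ k)))
                      (cong₂ (λ x y → x * u (+ k) + y * v (+ k)) a≡ b≡))
               (bezout (+ k))))
      (trans (cong₂ (λ x y → 1ℤ + floorSum x y (u (+ k)) (v (+ k)) 0ℤ (m (index k))) a≡ b≡)
             (cong (λ z → 1ℤ + floorSum (f (at (+ k))) (g (at (+ k))) (u (+ k)) (v (+ k)) 0ℤ z) m≡))
      where
      lem : ∀ a b u v → a * u + b * v + a * b * 0ℤ ≡ a * u + b * v
      lem = solve-∀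

lemma4p1 :
  (a₁ a₂ m : ℕ → ℤ)
  (A₁ : IsQuasiPolynomial a₁) (A₂ : IsQuasiPolynomial a₂) (M : IsQuasiPolynomial m) →
  HasPositiveLeadingCoefficients A₁ →
  HasPositiveLeadingCoefficients A₂ →
  HasPositiveLeadingCoefficients M →
  IsGGCD (a₁ ∷ a₂ ∷ []) (λ _ → 1ℤ) →
  Σ[ p ∈ (ℕ → ℕ) ]
    ( (∀ n → 0ℤ < a₁ n → 0ℤ < a₂ n →
         Solutions (a₁ n) (a₂ n) (m n) HasCardinality p n)
    × IsQuasiPolynomial (λ n → + p n)
    × (∀ u₁ u₂ → IsInverse a₁ a₂ u₁ → IsInverse a₂ a₁ u₂ →
         ∀ n (a₁>0 : 0ℤ < a₁ n) (a₂>0 : 0ℤ < a₂ n) → 0ℤ ≤ m n →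
         (+ p n) / 1 ≡
           countFormula (a₁ n) (a₂ n) (u₁ n) (u₂ n) (m n)
             {{>-nonZero a₁>0}} {{>-nonZero a₂>0}}))
lemma4p1 a₁ a₂ m A₁ A₂ M A₁>0 A₂>0 M>0 ggcd≡1 =
  p , (λ n → count-solutions (a₁ n) (a₂ n) (m n) (cop n)) , qp⇒isQuasiPolynomial p-qp , formula
  where
  cop : ∀ n → 0ℤ < a₁ n → 0ℤ < a₂ n → Coprime (a₁ n) (a₂ n)
  cop = ggcd-coprime ggcd≡1

  p : ℕ → ℕ
  p n = count (a₁ n) (a₂ n) (m n) (cop n)

  formula : ∀ u₁ u₂ → IsInverse a₁ a₂ u₁ → IsInverse a₂ a₁ u₂ →
    ∀ n (a₁>0 : 0ℤ < a₁ n) (a₂>0 : 0ℤ < a₂ n) → 0ℤ ≤ m n →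
    (+ p n) / 1 ≡ countFormula (a₁ n) (a₂ n) (u₁ n) (u₂ n) (m n) {{>-nonZero a₁>0}} {{>-nonZero a₂>0}}
  formula u₁ u₂ (_ , v₁ , _ , inv₁) (_ , v₂ , _ , inv₂) n a₁>0 a₂>0 0≤m =
    trans (cong (_/ 1) (count≡ (a₁ n) (a₂ n) (u₁ n) (u₂ n) w (m n) (cop n) a₁>0 a₂>0 0≤m bezout))
          (sym (formula-value a₁>0 a₂>0 bezout))
    where
    w : ℤ
    -- Multiplying 1 - a₁ u₁ = a₂ v₁ by 1 - a₂ u₂ = a₁ v₂ and expanding gives a₁ u₁ + a₂ u₂ + a₁ a₂
    -- (v₁ v₂ - u₁ u₂) = 1.
    w = v₁ n * v₂ n - u₁ n * u₂ n
    lem₁ : ∀ a b u v x y → a * u + b * v + a * b * (x * y - u * v) ≡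
      (a * u) + b * v - (a * u) * (b * v) + (b * x) * (a * y)
    lem₁ = solve-∀
    lem₂ : ∀ s t → s + t - s * t + (1ℤ - s) * (1ℤ - t) ≡ 1ℤ
    lem₂ = solve-∀
    complement : ∀ s t → s + t ≡ 1ℤ → t ≡ 1ℤ - s
    complement s t eq = trans (lem s t) (cong (_- s) eq)
      where
      lem : ∀ s t → t ≡ s + t - s
      lem = solve-∀
    bezout : a₁ n * u₁ n + a₂ n * u₂ n + a₁ n * a₂ n * w ≡ 1ℤ
    bezout = trans (lem₁ (a₁ n) (a₂ n) (u₁ n) (u₂ n) (v₁ n) (v₂ n))
      (trans (cong₂ (λ x y → a₁ n * u₁ n + a₂ n * u₂ n - (a₁ n * u₁ n) * (a₂ n * u₂ n) + x * y)
               (complement (a₁ n * u₁ n) (a₂ n * v₁ n) (inv₁ n))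
               (complement (a₂ n * u₂ n) (a₁ n * v₂ n) (inv₂ n)))
             (lem₂ (a₁ n * u₁ n) (a₂ n * u₂ n)))

  all-positive : Eventually (λ n → 0ℤ < a₁ n × 0ℤ < a₂ n × 0ℤ < m n)
  all-positive = ev-zip (λ _ → _,_) (eventually-positive A₁ A₁>0)
    (ev-zip (λ _ → _,_) (eventually-positive A₂ A₂>0) (eventually-positive M M>0))

  p-qp : QP (λ n → + p n)
  p-qp =
    let T , T≢0 , class = common-period family family-qp 3
    in qp-merge T {{T≢0}} λ i → count-qp (λ k → cop (T ℕ.* k ℕ.+ i))
         (class 0 (ℕ.s≤s ℕ.z≤n) i)
         (class 1 (ℕ.s≤s (ℕ.s≤s ℕ.z≤n)) i)
         (class 2 (ℕ.s≤s (ℕ.s≤s (ℕ.s≤s ℕ.z≤n))) i)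
         (ev-subsequence (λ k → T ℕ.* k ℕ.+ i) (λ k → k≤L*k+r T i k {{T≢0}}) all-positive)
    where
    -- Listing the three sequences as one family lets `common-period` make all of them polynomial on
    -- the same classes.
    family : ℕ → ℕ → ℤ
    family 0 = a₁
    family 1 = a₂
    family _ = m

    family-qp : ∀ i → QP (family i)
    family-qp 0             = isQuasiPolynomial⇒qp A₁
    family-qp 1             = isQuasiPolynomial⇒qp A₂
    family-qp (suc (suc _)) = isQuasiPolynomial⇒qp M
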